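{- There is a deterministic algorithm $\mathcal{A}_{\mathrm{InstanceOpt}}$ with the following guarantee. Given as input a randomized $q$-query algorithm $R:\{0,1\}^n\times\{0,1\}^m\to[0,1]$ with description length $N$ and an error parameter $\varepsilon\in(0,\frac12)$, let $q^\star_R$ denote the minimum query complexity of any deterministic query algorithm that $\varepsilon$-approximates $R$: $$q^\star_R:=\min\{\,q' : \text{there is a } q'\text{ -query deterministic decision tree } D \text{ that } \varepsilon\text{ -approximates } R\,\}.$$ Then $\mathcal{A}_{\mathrm{InstanceOpt}}$ runs in time $\mathrm{poly}(N)\cdot n^{O(q^\star_R)}$ and returns a deterministic $q^\star_R$-query algorithm $D:\{0,1\}^n\to[0,1]$ satisfying $$\mathop{\mathbb{E}}_{x}\Big[\big(D(x)-\mathop{\mathbb{E}}_{r}[R(x,r)]\big)^2\Big]\le\varepsilon,$$ where $x\sim\{0,1\}^n$ and $r\sim\{0,1\}^m$ are uniformly random.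
   Context: Query algorithms are represented as binary decision trees. An $n$-variable randomized decision tree (RDT) is a binary tree with two types of internal nodes: decision nodes, which branch on the value of one of the boolean variables $x_1,\dots,x_n$, and stochastic nodes, which branch on the outcome of an independent $\mathrm{Bernoulli}(\frac12)$ random bit. Leaves are labelled by values in $[0,1]$. Its query complexity is the maximum number of decision nodes on any root-to-leaf path, and its randomness complexity is the maximum number $m$ of stochastic nodes on any root-to-leaf path. The RDT computes a function $R:\{0,1\}^n\times\{0,1\}^m\to[0,1]$, where $R(x,r)$ is the label of the leaf reached on input $x$ when the stochastic nodes encountered branch according to the bits of $r$. A randomized $q$-query algorithm is an RDT of query complexity at most $q$. A deterministic decision tree (DDT), or deterministic query algorithm, is an RDT with no stochastic nodes. The description length is the length of the description of the tree. A DDT $D:\{0,1\}^n\to[0,1]$ $\varepsilon$-approximates $R$ if $\mathbb{E}_{x}[(D(x)-\mathbb{E}_{r}[R(x,r)])^2]\le\varepsilon$ for uniform $x\sim\{0,1\}^n$, $r\sim\{0,1\}^m$. Constants in $O(\cdot)$ and $\mathrm{poly}(\cdot)$ are absolute.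
   Formalization: Leaf labels of R and of the deterministic trees over which the minimum is taken are rational numbers in [0,1] rather than arbitrary reals; ε is real, given to the algorithm through comparisons of fractions with ε. -}

module Defs where

open import Data.Bool.Base using (Bool; true; false; T; if_then_else_)
open import Data.Fin.Base using (Fin; toℕ)
open import Data.Integer.Base using (+_; ∣_∣)
open import Data.Nat.Base
  using (ℕ; zero; suc; _+_; _*_; _∸_; _≤_; _⊔_; _≤ᵇ_)
open import Data.Nat.Logarithm using (⌊log₂_⌋)
open import Data.Nat.Properties using (m≤m⊔n; m≤n⊔m)
open import Data.Product.Base using (_×_; _,_; ∃-syntax)
open import Data.Rational.Unnormalised.Base as ℚ
  using (ℚᵘ; mkℚᵘ; 0ℚᵘ; 1ℚᵘ; ½; ↥_; ↧ₙ_)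
open import Data.Vec.Base using (Vec; []; _∷_; lookup; truncate)
open import Relation.Binary.PropositionalEquality using (_≡_; refl)
open import Relation.Nullary.Negation.Core using (¬_)

------------------------------------------------------------------------
-- Decision trees

-- Labels are fractions, so that a tree has a finite description.
record Label : Set where
  field
    value : ℚᵘ
    0≤    : 0ℚᵘ ℚ.≤ value
    ≤1    : value ℚ.≤ 1ℚᵘ

data Kind : Set where
  randomised deterministic : Kind

-- In both kinds of internal node the first subtree is taken on the
-- outcome false and the second on the outcome true.  A variable may be
-- queried repeatedly along a path.
data Tree (n : ℕ) : Kind → Set where
  leaf  : ∀ {k} → Label → Tree n k
  query : ∀ {k} → Fin n → Tree n k → Tree n k → Tree n k
  toss  : Tree n randomised → Tree n randomised → Tree n randomised

RDT DDT : ℕ → Set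
RDT n = Tree n randomised
DDT n = Tree n deterministic

queries : ∀ {n k} → Tree n k → ℕ
queries (leaf _)        = 0
queries (query _ t₀ t₁) = suc (queries t₀ ⊔ queries t₁)
queries (toss t₀ t₁)    = queries t₀ ⊔ queries t₁

randomness : ∀ {n k} → Tree n k → ℕ
randomness (leaf _)        = 0
randomness (query _ t₀ t₁) = randomness t₀ ⊔ randomness t₁
randomness (toss t₀ t₁)    = suc (randomness t₀ ⊔ randomness t₁)

-- The j-th stochastic node met on a path branches on the j-th bit of r;
-- bits beyond the randomness complexity of a subtree are dropped.
evalR : ∀ {n} (R : RDT n) → Vec Bool n → Vec Bool (randomness R) → ℚᵘ
evalR (leaf ℓ) x r = Label.value ℓ
evalR (query i t₀ t₁) x r =
  if lookup x i
  then evalR t₁ x (truncate (m≤n⊔m (randomness t₀) (randomness t₁)) r)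
  else evalR t₀ x (truncate (m≤m⊔n (randomness t₀) (randomness t₁)) r)
evalR (toss t₀ t₁) x (b ∷ r) =
  if b
  then evalR t₁ x (truncate (m≤n⊔m (randomness t₀) (randomness t₁)) r)
  else evalR t₀ x (truncate (m≤m⊔n (randomness t₀) (randomness t₁)) r)

evalD : ∀ {n} → DDT n → Vec Bool n → ℚᵘ
evalD (leaf ℓ)        x = Label.value ℓ
evalD (query i t₀ t₁) x = if lookup x i then evalD t₁ x else evalD t₀ x

-- Expectation over a uniformly random bit vector, one bit at a time.
𝔼 : (k : ℕ) → (Vec Bool k → ℚᵘ) → ℚᵘ
𝔼 zero    f = f []
𝔼 (suc k) f =
  ½ ℚ.* (𝔼 k (λ v → f (false ∷ v)) ℚ.+ 𝔼 k (λ v → f (true ∷ v)))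

square : ℚᵘ → ℚᵘ
square p = p ℚ.* p

error : ∀ {n} → DDT n → RDT n → ℚᵘ
error {n} D R =
  𝔼 n (λ x → square (evalD D x ℚ.- 𝔼 (randomness R) (λ r → evalR R x r)))

------------------------------------------------------------------------
-- Real error parameters

-- A real number α given by its rational lower set { p ∣ p ≤ α }; it is
-- closed, so that it describes comparison with ≤ and not with <.
record Cut : Set where
  field
    atMost : ℚᵘ → Bool
    down   : ∀ {p q} → p ℚ.≤ q → T (atMost q) → T (atMost p)
    closed : ∀ {q} → (∀ p → p ℚ.< q → T (atMost p)) → T (atMost q)

_≤ᶜ_ : ℚᵘ → Cut → Set
p ≤ᶜ α = T (Cut.atMost α p)

-- α ∈ (0 , ½)
InUnitHalf : Cut → Set
InUnitHalf α = (∃[ p ] (0ℚᵘ ℚ.< p × p ≤ᶜ α)) × ¬ (½ ≤ᶜ α)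

_Approximates[_]_ : ∀ {n} → DDT n → Cut → RDT n → Set
D Approximates[ ε ] R = error D R ≤ᶜ ε

Achievable : ∀ {n} → RDT n → Cut → ℕ → Set
Achievable {n} R ε q = ∃[ D ] (queries {n} D ≤ q × D Approximates[ ε ] R)

-- q is the minimum q⋆ of the query complexities achieving error ε.
IsOptimal : ∀ {n} → RDT n → Cut → ℕ → Set
IsOptimal R ε q = Achievable R ε q × (∀ q′ → Achievable R ε q′ → q ≤ q′)

------------------------------------------------------------------------
-- Machine data and descriptions

data Value : Set where
  nat  : ℕ → Value
  pair : Value → Value → Value

bits : ℕ → ℕ
bits m = suc ⌊log₂ m ⌋

size : Value → ℕ
size (nat m)    = bits m
size (pair v w) = suc (size v + size w)

encodeLabel : Label → Value
encodeLabel ℓ = pair (nat ∣ ↥ Label.value ℓ ∣) (nat (↧ₙ Label.value ℓ))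

encode : ∀ {n k} → Tree n k → Value
encode (leaf ℓ)        = pair (nat 0) (encodeLabel ℓ)
encode (query i t₀ t₁) =
  pair (nat 1) (pair (nat (toℕ i)) (pair (encode t₀) (encode t₁)))
encode (toss t₀ t₁)    = pair (nat 2) (pair (encode t₀) (encode t₁))

descriptionLength : ∀ {n k} → Tree n k → ℕ
descriptionLength t = size (encode t)

------------------------------------------------------------------------
-- Algorithms and their running time

-- A first-order language with recursive functions of one argument, acting
-- on binary trees with natural numbers at the leaves: k functions can be
-- called and s variables are in scope.
data Expr (k s : ℕ) : Set where
  var             : Fin s → Expr k s
  lit             : ℕ → Expr k s
  cons            : Expr k s → Expr k s → Expr k s
  fst snd         : Expr k s → Expr k s
  plus monus mult : Expr k s → Expr k s → Expr k s
  leq             : Expr k s → Expr k s → Expr k s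
  -- fracLeqε a b tests a / b ≤ ε; it is the only access to ε.
  fracLeqε        : Expr k s → Expr k s → Expr k s
  cond            : Expr k s → Expr k s → Expr k s → Expr k s
  bind            : Expr k s → Expr k (suc s) → Expr k s
  call            : Fin k → Expr k s → Expr k s

record Program : Set where
  field
    {count}   : ℕ
    functions : Vec (Expr count 1) count
    main      : Expr count 1

truth : Bool → Value
truth false = nat 0
truth true  = nat 1

-- ρ ⊢ e ⇓ v ∣ t : e evaluates to v in time t.  Every step costs one unit,
-- as pairs are handled by reference, except that arithmetic and
-- comparisons also pay for the lengths of their operands (logarithmic
-- cost).  Evaluations that go wrong or diverge have no derivation.
module Semantics {k : ℕ} (fs : Vec (Expr k 1) k) (ε : Cut) where

  infix 3 _⊢_⇓_∣_

  data _⊢_⇓_∣_ {s : ℕ} (ρ : Vec Value s) : Expr k s → Value → ℕ → Set where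
    ⇓var : ∀ {i} → ρ ⊢ var i ⇓ lookup ρ i ∣ 1
    ⇓lit : ∀ {m} → ρ ⊢ lit m ⇓ nat m ∣ bits m
    ⇓cons : ∀ {e₁ e₂ v₁ v₂ t₁ t₂} →
      ρ ⊢ e₁ ⇓ v₁ ∣ t₁ → ρ ⊢ e₂ ⇓ v₂ ∣ t₂ →
      ρ ⊢ cons e₁ e₂ ⇓ pair v₁ v₂ ∣ suc (t₁ + t₂)
    ⇓fst : ∀ {e v w t} → ρ ⊢ e ⇓ pair v w ∣ t → ρ ⊢ fst e ⇓ v ∣ suc t
    ⇓snd : ∀ {e v w t} → ρ ⊢ e ⇓ pair v w ∣ t → ρ ⊢ snd e ⇓ w ∣ suc t
    ⇓plus : ∀ {e₁ e₂ a b t₁ t₂} →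
      ρ ⊢ e₁ ⇓ nat a ∣ t₁ → ρ ⊢ e₂ ⇓ nat b ∣ t₂ →
      ρ ⊢ plus e₁ e₂ ⇓ nat (a + b) ∣ suc (t₁ + t₂ + (bits a + bits b))
    ⇓monus : ∀ {e₁ e₂ a b t₁ t₂} →
      ρ ⊢ e₁ ⇓ nat a ∣ t₁ → ρ ⊢ e₂ ⇓ nat b ∣ t₂ →
      ρ ⊢ monus e₁ e₂ ⇓ nat (a ∸ b) ∣ suc (t₁ + t₂ + (bits a + bits b))
    ⇓mult : ∀ {e₁ e₂ a b t₁ t₂} →
      ρ ⊢ e₁ ⇓ nat a ∣ t₁ → ρ ⊢ e₂ ⇓ nat b ∣ t₂ →
      ρ ⊢ mult e₁ e₂ ⇓ nat (a * b) ∣ suc (t₁ + t₂ + (bits a + bits b))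
    ⇓leq : ∀ {e₁ e₂ a b t₁ t₂} →
      ρ ⊢ e₁ ⇓ nat a ∣ t₁ → ρ ⊢ e₂ ⇓ nat b ∣ t₂ →
      ρ ⊢ leq e₁ e₂ ⇓ truth (a ≤ᵇ b) ∣ suc (t₁ + t₂ + (bits a + bits b))
    ⇓fracLeqε : ∀ {e₁ e₂ a b t₁ t₂} →
      ρ ⊢ e₁ ⇓ nat a ∣ t₁ → ρ ⊢ e₂ ⇓ nat (suc b) ∣ t₂ →
      ρ ⊢ fracLeqε e₁ e₂ ⇓ truth (Cut.atMost ε (mkℚᵘ (+ a) b))
        ∣ suc (t₁ + t₂ + (bits a + bits (suc b)))
    ⇓condᵗ : ∀ {e e₁ e₂ m v t t₁} →
      ρ ⊢ e ⇓ nat (suc m) ∣ t → ρ ⊢ e₁ ⇓ v ∣ t₁ →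
      ρ ⊢ cond e e₁ e₂ ⇓ v ∣ suc (t + t₁)
    ⇓condᶠ : ∀ {e e₁ e₂ v t t₂} →
      ρ ⊢ e ⇓ nat 0 ∣ t → ρ ⊢ e₂ ⇓ v ∣ t₂ →
      ρ ⊢ cond e e₁ e₂ ⇓ v ∣ suc (t + t₂)
    ⇓bind : ∀ {e₁ e₂ v₁ v₂ t₁ t₂} →
      ρ ⊢ e₁ ⇓ v₁ ∣ t₁ → v₁ ∷ ρ ⊢ e₂ ⇓ v₂ ∣ t₂ →
      ρ ⊢ bind e₁ e₂ ⇓ v₂ ∣ suc (t₁ + t₂)
    ⇓call : ∀ {f e v w t₁ t₂} →
      ρ ⊢ e ⇓ v ∣ t₁ → v ∷ [] ⊢ lookup fs f ⇓ w ∣ t₂ →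
      ρ ⊢ call f e ⇓ w ∣ suc (t₁ + t₂)

  ⇓-deterministic : ∀ {s} {ρ : Vec Value s} {e v v′ t t′} →
    ρ ⊢ e ⇓ v ∣ t → ρ ⊢ e ⇓ v′ ∣ t′ → v ≡ v′ × t ≡ t′
  ⇓-deterministic ⇓var ⇓var = refl , refl
  ⇓-deterministic ⇓lit ⇓lit = refl , refl
  ⇓-deterministic (⇓cons p q) (⇓cons p′ q′)
    with refl , refl ← ⇓-deterministic p p′
       | refl , refl ← ⇓-deterministic q q′ = refl , refl
  ⇓-deterministic (⇓fst p) (⇓fst p′)
    with refl , refl ← ⇓-deterministic p p′ = refl , refl
  ⇓-deterministic (⇓snd p) (⇓snd p′)
    with refl , refl ← ⇓-deterministic p p′ = refl , refl
  ⇓-deterministic (⇓plus p q) (⇓plus p′ q′)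
    with refl , refl ← ⇓-deterministic p p′
       | refl , refl ← ⇓-deterministic q q′ = refl , refl
  ⇓-deterministic (⇓monus p q) (⇓monus p′ q′)
    with refl , refl ← ⇓-deterministic p p′
       | refl , refl ← ⇓-deterministic q q′ = refl , refl
  ⇓-deterministic (⇓mult p q) (⇓mult p′ q′)
    with refl , refl ← ⇓-deterministic p p′
       | refl , refl ← ⇓-deterministic q q′ = refl , refl
  ⇓-deterministic (⇓leq p q) (⇓leq p′ q′)
    with refl , refl ← ⇓-deterministic p p′
       | refl , refl ← ⇓-deterministic q q′ = refl , refl
  ⇓-deterministic (⇓fracLeqε p q) (⇓fracLeqε p′ q′)
    with refl , refl ← ⇓-deterministic p p′
       | refl , refl ← ⇓-deterministic q q′ = refl , refl
  ⇓-deterministic (⇓condᵗ p q) (⇓condᵗ p′ q′)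
    with refl , refl ← ⇓-deterministic p p′
       | refl , refl ← ⇓-deterministic q q′ = refl , refl
  ⇓-deterministic (⇓condᵗ p q) (⇓condᶠ p′ q′)
    with () , _ ← ⇓-deterministic p p′
  ⇓-deterministic (⇓condᶠ p q) (⇓condᵗ p′ q′)
    with () , _ ← ⇓-deterministic p p′
  ⇓-deterministic (⇓condᶠ p q) (⇓condᶠ p′ q′)
    with refl , refl ← ⇓-deterministic p p′
       | refl , refl ← ⇓-deterministic q q′ = refl , refl
  ⇓-deterministic (⇓bind p q) (⇓bind p′ q′)
    with refl , refl ← ⇓-deterministic p p′
    with refl , refl ← ⇓-deterministic q q′ = refl , refl
  ⇓-deterministic (⇓call p q) (⇓call p′ q′)
    with refl , refl ← ⇓-deterministic p p′
    with refl , refl ← ⇓-deterministic q q′ = refl , refl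

-- On arity n, tree R and parameter ε, the program returns D in the given
-- time.  The time includes writing D out in full, since shared subtrees
-- could otherwise make the result far larger than the time spent.
record Returns {n : ℕ} (A : Program) (R : RDT n) (ε : Cut)
               (D : DDT n) (time : ℕ) : Set where
  open Program A
  open Semantics functions ε
  field
    {steps}   : ℕ
    evaluates : pair (nat n) (encode R) ∷ [] ⊢ main ⇓ encode D ∣ steps
    total     : time ≡ steps + descriptionLength D

module Submission where

-- For a partial assignment σ let f be the conditional mean of R over its
-- random bits, restricted to the completions of σ.  A constant l has mean
-- squared error at least the variance of f, with equality when l is the mean
-- of f.  A tree that queries a variable i not fixed by σ has as error the
-- average of the errors of its subtrees under the two extensions of σ by i,
-- and querying a variable that σ fixes is useless.  Hence an optimal tree of
-- depth d + 1 for σ is found by comparing an optimal tree of depth d for σ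
-- with, for every free variable i, the tree that queries i and continues
-- with optimal trees of depth d for the two extensions.  This recursion is
-- best; best-sound and best-optimal say that it computes its own error and
-- that no tree of the same depth does better.
--
-- The algorithm computes best for d = 0, 1, 2, ... until the error is at
-- most ε.  It stops by depth n, since the tree that queries every variable
-- has error 0 (best-full), and the depth at which it stops is q⋆.
--
-- The mean of f and of its square are moments, that is expectations of
-- products of copies of f.  A moment is found by walking down the trees one
-- after the other and recording in σ the answers to the queries met so far;
-- for the second moment this visits a number of nodes that is quadratic in
-- the size N of R.  Fractions are never reduced: their lengths add up under
-- products and averages, so that they are polynomial in N for a moment and
-- about double with each level of best.
--
-- The program below does this literally.  Its evaluation is followed by the
-- relations Run and Calls, which bound the time from above: every step costs
-- at most 3 W, where W bounds the lengths of the numbers involved.  The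
-- time of best at depth d is at most (7 (n + 1)) ^ d times a polynomial in
-- N and q⋆ (4 + n) (best-calls).  The last term accounts for the assignments
-- and vanishes at depth 0, where n is not read; therefore the total is
-- polynomial in N alone when q⋆ = 0.  When q⋆ > 0 the powers of n are
-- absorbed by n ^ (14 q⋆), and the factors c ^ q⋆ are as well, because
-- 2 ^ q ≤ 2 n ^ q for q ≤ n (time-bound).

open import Defs
open import Data.Nat.Base using (ℕ; _≤_; _*_; _^_)
open import Data.Product.Base using (_×_; ∃-syntax)

open import Data.Bool.Base using (Bool; true; false; T; if_then_else_)
open import Data.Fin using (#_)
open import Data.Fin.Base using (Fin; zero; suc; toℕ; fromℕ<)
open import Data.Fin.Properties using (_≟_; toℕ-fromℕ<; toℕ<n; toℕ-injective)
open import Data.Integer.Base as ℤ using (+_; -[1+_]; ∣_∣; +≤+)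
import Data.Integer.Properties as ℤP
open import Data.List.Base using (List; []; _∷_; _++_; length)
open import Data.Maybe.Base using (Maybe; just; nothing)
open import Data.Nat.Base
  using (zero; suc; _+_; _∸_; _<_; _≤ᵇ_; z≤n; s≤s; ⌊_/2⌋; ⌈_/2⌉; >-nonZero)
open import Data.Nat.Induction using (<-wellFounded)
open import Data.Nat.ListAction using (sum)
open import Data.Nat.ListAction.Properties using (sum-++)
open import Data.Nat.Logarithm using (⌊log₂⌋-mono-≤; ⌊log₂[2^n]⌋≡n)
open import Data.Nat.Logarithm.Core using (⌊log2⌋)
open import Data.Nat.Properties hiding (_≟_)
open import Data.Nat.Solver using (module +-*-Solver)
open import Data.Product.Base using (_,_; proj₁; proj₂)
open import Data.Rational.Unnormalised.Base as ℚ
  using (ℚᵘ; mkℚᵘ; 0ℚᵘ; 1ℚᵘ; ½; _≃_; *≡*; *≤*; ↥_)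
import Data.Rational.Unnormalised.Properties as ℚP
import Data.Rational.Unnormalised.Solver as ℚSolver
open import Data.Sum.Base using (_⊎_; inj₁; inj₂)
open import Data.Unit.Base using (tt)
open import Data.Vec.Base using (Vec; []; _∷_; lookup; tabulate; truncate; _[_]≔_)
open import Data.Vec.Properties using (lookup∘update; lookup∘update′; tabulate∘lookup)
open import Function.Base using (_∘_; id)
import Induction.WellFounded as WF
open import Relation.Binary.PropositionalEquality
  using (_≡_; _≢_; refl; sym; trans; cong; cong₂; subst; subst₂; module ≡-Reasoning)
import Relation.Binary.Reasoning.Setoid as SetoidReasoning
open import Relation.Nullary.Decidable.Core using (yes; no)
open import Relation.Nullary.Negation.Core using (contradiction)

module ≃-Reasoning = SetoidReasoning ℚP.≃-setoid

------------------------------------------------------------------------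
-- Averages and expectations over random bits

avg : ℚᵘ → ℚᵘ → ℚᵘ
avg p q = ½ ℚ.* (p ℚ.+ q)

-- Identities proved by the ring solver.  The factor ½ is passed as a variable,
-- as the solver does not know that ½ + ½ is 1.
module ℚIdentities where
  open ℚSolver.+-*-Solver using (solve; _:=_; _:+_; _:*_; :-_; con)

  ½-double : ∀ p → ½ ℚ.* (p ℚ.+ p) ≃ (½ ℚ.+ ½) ℚ.* p
  ½-double = solve 2 (λ h p → h :* (p :+ p) := (h :+ h) :* p) ℚP.≃-refl ½

  avg-+ : ∀ a b c d → avg (a ℚ.+ b) (c ℚ.+ d) ≃ avg a c ℚ.+ avg b d
  avg-+ = solve 5 (λ h a b c d →
    h :* ((a :+ b) :+ (c :+ d)) := (h :* (a :+ c)) :+ (h :* (b :+ d))) ℚP.≃-refl ½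

  avg-* : ∀ c a b → avg (c ℚ.* a) (c ℚ.* b) ≃ c ℚ.* avg a b
  avg-* = solve 4 (λ h c a b →
    h :* ((c :* a) :+ (c :* b)) := c :* (h :* (a :+ b))) ℚP.≃-refl ½

  avg-*ʳ : ∀ a b c → avg a b ℚ.* c ≃ avg (a ℚ.* c) (b ℚ.* c)
  avg-*ʳ = solve 4 (λ h a b c →
    (h :* (a :+ b)) :* c := h :* ((a :* c) :+ (b :* c))) ℚP.≃-refl ½

  avg-interchange : ∀ a b c d → avg (avg a b) (avg c d) ≃ avg (avg a c) (avg b d)
  avg-interchange = solve 5 (λ h a b c d →
    h :* ((h :* (a :+ b)) :+ (h :* (c :+ d))) :=
    h :* ((h :* (a :+ c)) :+ (h :* (b :+ d)))) ℚP.≃-refl ½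

  square-neg : ∀ p → square (ℚ.- p) ≃ square p
  square-neg = solve 1 (λ p → (:- p) :* (:- p) := p :* p) ℚP.≃-refl

  -- The factor 1 comes from the empty product at the end of a moment.
  square-expand : ∀ l m → square (l ℚ.- m) ≃
    m ℚ.* (m ℚ.* 1ℚᵘ) ℚ.+ (ℚ.- (l ℚ.+ l) ℚ.* (m ℚ.* 1ℚᵘ) ℚ.+ l ℚ.* l)
  square-expand = solve 2 (λ l m → (l :+ (:- m)) :* (l :+ (:- m)) :=
    m :* (m :* con 1ℚᵘ) :+ ((:- (l :+ l)) :* (m :* con 1ℚᵘ) :+ l :* l)) ℚP.≃-refl

  complete-square : ∀ l m s →
    (s ℚ.- m ℚ.* m) ℚ.+ square (l ℚ.- m) ≃ s ℚ.+ (ℚ.- (l ℚ.+ l) ℚ.* m ℚ.+ l ℚ.* l)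
  complete-square = solve 3 (λ l m s →
    (s :+ (:- (m :* m))) :+ (l :+ (:- m)) :* (l :+ (:- m)) :=
    s :+ ((:- (l :+ l)) :* m :+ l :* l)) ℚP.≃-refl

  cancel-double : ∀ l m → ℚ.- (l ℚ.+ l) ℚ.* m ℚ.+ l ℚ.* m ≃ ℚ.- (l ℚ.* m)
  cancel-double = solve 2 (λ l m → (:- (l :+ l)) :* m :+ l :* m := (:- (l :* m))) ℚP.≃-refl

open ℚIdentities
open +-*-Solver using (solve; _:=_; _:+_; _:*_; _:^_; con)

avg-cong : ∀ {p p′ q q′} → p ≃ p′ → q ≃ q′ → avg p q ≃ avg p′ q′
avg-cong p≃ q≃ = ℚP.*-congˡ {½} (ℚP.+-cong p≃ q≃)

avg-mono : ∀ {p p′ q q′} → p ℚ.≤ p′ → q ℚ.≤ q′ → avg p q ℚ.≤ avg p′ q′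
avg-mono p≤ q≤ = ℚP.*-monoʳ-≤-nonNeg ½ (ℚP.+-mono-≤ p≤ q≤)

avg-idem : ∀ p → avg p p ≃ p
avg-idem p = begin
  ½ ℚ.* (p ℚ.+ p)  ≈⟨ ½-double p ⟩
  (½ ℚ.+ ½) ℚ.* p  ≈⟨ ℚP.*-congʳ {p} {½ ℚ.+ ½} {1ℚᵘ} (*≡* refl) ⟩
  1ℚᵘ ℚ.* p        ≈⟨ ℚP.*-identityˡ p ⟩
  p                ∎
  where open ≃-Reasoning

-- The restriction of f to the vectors that begin with b.
half : ∀ {k} → (Vec Bool (suc k) → ℚᵘ) → Bool → Vec Bool k → ℚᵘ
half f b v = f (b ∷ v)

𝔼-cong : ∀ k {f g} → (∀ v → f v ≃ g v) → 𝔼 k f ≃ 𝔼 k g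
𝔼-cong zero    f≃g = f≃g []
𝔼-cong (suc k) f≃g =
  avg-cong (𝔼-cong k λ v → f≃g (false ∷ v)) (𝔼-cong k λ v → f≃g (true ∷ v))

𝔼-mono : ∀ k {f g} → (∀ v → f v ℚ.≤ g v) → 𝔼 k f ℚ.≤ 𝔼 k g
𝔼-mono zero    f≤g = f≤g []
𝔼-mono (suc k) f≤g =
  avg-mono (𝔼-mono k λ v → f≤g (false ∷ v)) (𝔼-mono k λ v → f≤g (true ∷ v))

𝔼-const : ∀ k p → 𝔼 k (λ _ → p) ≃ p
𝔼-const zero    p = ℚP.≃-refl
𝔼-const (suc k) p =
  ℚP.≃-trans (avg-cong (𝔼-const k p) (𝔼-const k p)) (avg-idem p)

𝔼-+ : ∀ k f g → 𝔼 k (λ v → f v ℚ.+ g v) ≃ 𝔼 k f ℚ.+ 𝔼 k g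
𝔼-+ zero    f g = ℚP.≃-refl
𝔼-+ (suc k) f g = ℚP.≃-trans
  (avg-cong (𝔼-+ k (half f false) (half g false)) (𝔼-+ k (half f true) (half g true)))
  (avg-+ (𝔼 k (half f false)) (𝔼 k (half g false)) (𝔼 k (half f true)) (𝔼 k (half g true)))

𝔼-* : ∀ k c f → 𝔼 k (λ v → c ℚ.* f v) ≃ c ℚ.* 𝔼 k f
𝔼-* zero    c f = ℚP.≃-refl
𝔼-* (suc k) c f = ℚP.≃-trans (avg-cong (𝔼-* k c (half f false)) (𝔼-* k c (half f true)))
  (avg-* c (𝔼 k (half f false)) (𝔼 k (half f true)))

-- Splitting an expectation on one coordinate of the argument.
𝔼-split : ∀ {n} (i : Fin n) f →
  𝔼 n f ≃ avg (𝔼 n λ x → f (x [ i ]≔ false)) (𝔼 n λ x → f (x [ i ]≔ true))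
𝔼-split {suc n} zero f = avg-cong
  (ℚP.≃-sym (avg-idem (𝔼 n (half f false)))) (ℚP.≃-sym (avg-idem (𝔼 n (half f true))))
𝔼-split {suc n} (suc i) f = ℚP.≃-trans
  (avg-cong (𝔼-split i (half f false)) (𝔼-split i (half f true)))
  (avg-interchange (E false false) (E false true) (E true false) (E true true))
  where
  E : Bool → Bool → ℚᵘ
  E b c = 𝔼 n λ x → f (b ∷ (x [ i ]≔ c))

-- Random bits that are dropped do not change an expectation.
𝔼-truncate : ∀ {m k} (m≤k : m ≤ k) f → 𝔼 k (λ r → f (truncate m≤k r)) ≃ 𝔼 m f
𝔼-truncate {zero} {k} z≤n f = 𝔼-const k (f [])
𝔼-truncate (s≤s m≤k) f = avg-cong (𝔼-truncate m≤k _) (𝔼-truncate m≤k _)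

0≤square : ∀ p → 0ℚᵘ ℚ.≤ square p
0≤square p = go p (ℚP.≤-total 0ℚᵘ p)
  where
  nonneg : ∀ p → 0ℚᵘ ℚ.≤ p → 0ℚᵘ ℚ.≤ square p
  nonneg p 0≤p = ℚP.≤-respˡ-≃ (ℚP.*-zeroʳ p) (ℚP.*-monoʳ-≤-nonNeg p {{ℚ.nonNegative 0≤p}} 0≤p)
  go : ∀ p → 0ℚᵘ ℚ.≤ p ⊎ p ℚ.≤ 0ℚᵘ → 0ℚᵘ ℚ.≤ square p
  go p (inj₁ 0≤p) = nonneg p 0≤p
  go p (inj₂ p≤0) = ℚP.≤-respʳ-≃ (square-neg p)
    (nonneg (ℚ.- p) (ℚP.neg-mono-≤ p≤0))

------------------------------------------------------------------------
-- The mean of a randomised tree over its random bits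

-- The conditional mean of a randomised tree, over its random bits.
μ : ∀ {n} → RDT n → Vec Bool n → ℚᵘ
μ R x = 𝔼 (randomness R) (evalR R x)

μ-toss : ∀ {n} (t₀ t₁ : RDT n) x → μ (toss t₀ t₁) x ≃ avg (μ t₀ x) (μ t₁ x)
μ-toss t₀ t₁ x = avg-cong
  (𝔼-truncate (m≤m⊔n (randomness t₀) (randomness t₁)) (evalR t₀ x))
  (𝔼-truncate (m≤n⊔m (randomness t₀) (randomness t₁)) (evalR t₁ x))

-- Selects in the order used by the trees: the first on false.
choose : ∀ {a} {A : Set a} → Bool → A → A → A
choose b a₀ a₁ = if b then a₁ else a₀

μ-query : ∀ {n} i (t₀ t₁ : RDT n) x {b} → lookup x i ≡ b →
  μ (query i t₀ t₁) x ≃ μ (choose b t₀ t₁) x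
μ-query i t₀ t₁ x {b} eq rewrite eq with b
... | false = 𝔼-truncate (m≤m⊔n (randomness t₀) (randomness t₁)) (evalR t₀ x)
... | true  = 𝔼-truncate (m≤n⊔m (randomness t₀) (randomness t₁)) (evalR t₁ x)

evalR-0≤ : ∀ {n} (R : RDT n) x r → 0ℚᵘ ℚ.≤ evalR R x r
evalR-0≤ (leaf ℓ) x r = Label.0≤ ℓ
evalR-0≤ (query i t₀ t₁) x r with lookup x i
... | false = evalR-0≤ t₀ x _
... | true  = evalR-0≤ t₁ x _
evalR-0≤ (toss t₀ t₁) x (false ∷ r) = evalR-0≤ t₀ x _
evalR-0≤ (toss t₀ t₁) x (true ∷ r)  = evalR-0≤ t₁ x _

evalR-≤1 : ∀ {n} (R : RDT n) x r → evalR R x r ℚ.≤ 1ℚᵘ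
evalR-≤1 (leaf ℓ) x r = Label.≤1 ℓ
evalR-≤1 (query i t₀ t₁) x r with lookup x i
... | false = evalR-≤1 t₀ x _
... | true  = evalR-≤1 t₁ x _
evalR-≤1 (toss t₀ t₁) x (false ∷ r) = evalR-≤1 t₀ x _
evalR-≤1 (toss t₀ t₁) x (true ∷ r)  = evalR-≤1 t₁ x _

------------------------------------------------------------------------
-- Unreduced fractions of natural numbers

-- The fraction num / (1 + den-1).  The operations on fractions mirror those of
-- the program exactly, so that the values of the program can be read off.
record Frac : Set where
  constructor _/1+_
  field
    num den-1 : ℕ
  den : ℕ
  den = suc den-1
open Frac

⟦_⟧ : Frac → ℚᵘ
⟦ a /1+ b ⟧ = mkℚᵘ (+ a) b

infixl 7 _⊗_
infixl 6 _⊖_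
-- Product, truncated difference and average, without cancellation.
_⊗_ _⊖_ mid : Frac → Frac → Frac
p ⊗ q = (num p * num q) /1+ (den-1 q + den-1 p * den q)
p ⊖ q = (num p * den q ∸ num q * den p) /1+ (den-1 q + den-1 p * den q)
mid p q = (num p * den q + num q * den p) /1+
  ((den-1 q + den-1 p * den q) + den p * den q)

oneF : Frac
oneF = 1 /1+ 0

-- Comparison by cross-multiplication.
_≤F_ : Frac → Frac → Bool
p ≤F q = (num p * den q) ≤ᵇ (num q * den p)

⟦⊗⟧ : ∀ p q → ⟦ p ⊗ q ⟧ ≃ ⟦ p ⟧ ℚ.* ⟦ q ⟧
⟦⊗⟧ p q = ℚP.≃-reflexive (cong (λ z → mkℚᵘ z (den-1 (p ⊗ q))) (ℤP.pos-* (num p) (num q)))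

cross : ∀ a b c d → + (a * b + c * d) ≡ + a ℤ.* + b ℤ.+ + c ℤ.* + d
cross a b c d = cong₂ ℤ._+_ (ℤP.pos-* a b) (ℤP.pos-* c d)

⟦mid⟧ : ∀ p q → ⟦ mid p q ⟧ ≃ avg ⟦ p ⟧ ⟦ q ⟧
⟦mid⟧ p q = ℚP.≃-reflexive (cong₂ mkℚᵘ
  (trans (cross (num p) (den q) (num q) (den p)) (sym (ℤP.*-identityˡ _)))
  (cong (λ z → (den-1 q + den-1 p * den q) + z) (sym (+-identityʳ _))))

≤-drop : ∀ p q → ⟦ p ⟧ ℚ.≤ ⟦ q ⟧ → num p * den q ≤ num q * den p
≤-drop p q (*≤* le) = ℤP.drop‿+≤+ (subst₂ ℤ._≤_ (sym (ℤP.pos-* (num p) (den q))) (sym (ℤP.pos-* (num q) (den p))) le)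

≤-lift : ∀ p q → num p * den q ≤ num q * den p → ⟦ p ⟧ ℚ.≤ ⟦ q ⟧
≤-lift p q le = *≤* (subst₂ ℤ._≤_ (ℤP.pos-* (num p) (den q)) (ℤP.pos-* (num q) (den p)) (+≤+ le))

-- The truncated difference is the difference when that is not negative.
⟦⊖⟧ : ∀ p q → ⟦ q ⟧ ℚ.≤ ⟦ p ⟧ → ⟦ p ⊖ q ⟧ ≃ ⟦ p ⟧ ℚ.- ⟦ q ⟧
⟦⊖⟧ p q q≤p = ℚP.≃-reflexive (cong (λ z → mkℚᵘ z (den-1 (p ⊖ q))) (begin
  + (num p * den q ∸ num q * den p)              ≡⟨ ℤP.⊖-≥ (≤-drop q p q≤p) ⟨
  num p * den q ℤ.⊖ num q * den p                ≡⟨ ℤP.m-n≡m⊖n (num p * den q) (num q * den p) ⟨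
  + (num p * den q) ℤ.- + (num q * den p)
    ≡⟨ cong₂ (λ y z → y ℤ.- z) (ℤP.pos-* (num p) (den q)) (ℤP.pos-* (num q) (den p)) ⟩
  + num p ℤ.* + den q ℤ.- + num q ℤ.* + den p
    ≡⟨ cong (λ z → + num p ℤ.* + den q ℤ.+ z) (ℤP.neg-distribˡ-* (+ num q) (+ den p)) ⟩
  + num p ℤ.* + den q ℤ.+ (ℤ.- + num q) ℤ.* + den p ∎))
  where open ≡-Reasoning

≤F-sound : ∀ p q {b} → (p ≤F q) ≡ b → if b then ⟦ p ⟧ ℚ.≤ ⟦ q ⟧ else ⟦ q ⟧ ℚ.≤ ⟦ p ⟧
≤F-sound p q {true}  eq = ≤-lift p q (≤ᵇ⇒≤ _ _ (subst T (sym eq) tt))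
≤F-sound p q {false} eq with ≤-total (num p * den q) (num q * den p)
... | inj₁ le = contradiction (subst T eq (≤⇒≤ᵇ le)) λ ()
... | inj₂ ge = ≤-lift q p ge

-- A label as a fraction of natural numbers.
labelFrac : Label → Frac
labelFrac ℓ = ∣ ↥ Label.value ℓ ∣ /1+ ℚᵘ.denominator-1 (Label.value ℓ)

⟦labelFrac⟧ : ∀ ℓ → ⟦ labelFrac ℓ ⟧ ≡ Label.value ℓ
⟦labelFrac⟧ record { value = mkℚᵘ (+ a) d }      = refl
⟦labelFrac⟧ record { value = mkℚᵘ -[1+ a ] d ; 0≤ = *≤* () }

-- Fractions at most 1, which may label leaves.
record Proper (p : Frac) : Set where
  constructor proper
  field num≤den : num p ≤ den p
open Proper

labelFrac-proper : ∀ ℓ → Proper (labelFrac ℓ)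
labelFrac-proper record { value = mkℚᵘ (+ a) d ; ≤1 = ≤1 } =
  proper (subst₂ _≤_ (*-identityʳ a) (*-identityˡ (suc d)) (≤-drop (a /1+ d) oneF ≤1))
labelFrac-proper record { value = mkℚᵘ -[1+ a ] d ; 0≤ = *≤* () }

⊗-proper : ∀ {p q} → Proper p → Proper q → Proper (p ⊗ q)
⊗-proper pp pq = proper (*-mono-≤ (num≤den pp) (num≤den pq))

mid-proper : ∀ {p q} → Proper p → Proper q → Proper (mid p q)
mid-proper {p} {q} pp pq = proper (+-mono-≤ (*-monoˡ-≤ (den q) (num≤den pp))
  (≤-trans (*-monoˡ-≤ (den p) (num≤den pq)) (≤-reflexive (*-comm (den q) (den p)))))

------------------------------------------------------------------------
-- Partial assignments and random completions

-- Partial assignments of the variables.  When a variable occurs more than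
-- once, the occurrence nearest the end of the list counts.
Assignment : ℕ → Set
Assignment n = List (Fin n × Bool)

-- The completion of σ that agrees with x on the variables σ leaves free.
override : ∀ {n} → Assignment n → Vec Bool n → Vec Bool n
override []            x = x
override ((i , b) ∷ σ) x = override σ (x [ i ]≔ b)

-- The value that σ gives to i, if any.
find : ∀ {n} → Assignment n → Fin n → Maybe Bool
find []            i = nothing
find ((j , b) ∷ σ) i with find σ i
... | just c = just c
... | nothing with i ≟ j
...   | yes _ = just b
...   | no _  = nothing

override-nothing : ∀ {n} (σ : Assignment n) x i → find σ i ≡ nothing →
  lookup (override σ x) i ≡ lookup x i
override-nothing [] x i eq = refl
override-nothing ((j , b) ∷ σ) x i eq with find σ i in eq′
override-nothing ((j , b) ∷ σ) x i () | just c
... | nothing with i ≟ j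
override-nothing ((j , b) ∷ σ) x i () | nothing | yes _
... | no i≢j = trans (override-nothing σ (x [ j ]≔ b) i eq′) (lookup∘update′ i≢j x b)

override-just : ∀ {n} (σ : Assignment n) x i {b} → find σ i ≡ just b →
  lookup (override σ x) i ≡ b
override-just ((j , b) ∷ σ) x i eq with find σ i in eq′
override-just ((j , b) ∷ σ) x i refl | just c = override-just σ (x [ j ]≔ b) i eq′
... | nothing with i ≟ j
override-just ((j , b) ∷ σ) x i refl | nothing | yes refl =
  trans (override-nothing σ (x [ j ]≔ b) j eq′) (lookup∘update j x b)

override-new : ∀ {n} (σ : Assignment n) x i b → find σ i ≡ nothing →
  lookup (override ((i , b) ∷ σ) x) i ≡ b
override-new σ x i b eq = trans (override-nothing σ (x [ i ]≔ b) i eq) (lookup∘update i x b)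

-- Expectation over a uniformly random completion of a partial assignment.
𝔼[_]_ : ∀ {n} → Assignment n → (Vec Bool n → ℚᵘ) → ℚᵘ
𝔼[_]_ {n} σ f = 𝔼 n (λ x → f (override σ x))

𝔼[]-cong : ∀ {n} (σ : Assignment n) {f g} → (∀ x → f (override σ x) ≃ g (override σ x)) →
  𝔼[ σ ] f ≃ 𝔼[ σ ] g
𝔼[]-cong {n} σ f≃g = 𝔼-cong n f≃g

𝔼-avg : ∀ k f g → 𝔼 k (λ v → avg (f v) (g v)) ≃ avg (𝔼 k f) (𝔼 k g)
𝔼-avg k f g = ℚP.≃-trans (𝔼-* k ½ (λ v → f v ℚ.+ g v)) (ℚP.*-congˡ {½} (𝔼-+ k f g))

-- Conditioning on a variable: f may be replaced by g₀ and g₁ on the two sides.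
𝔼[]-branch : ∀ {n} (σ : Assignment n) i → find σ i ≡ nothing → ∀ f (g : Bool → Vec Bool n → ℚᵘ) →
  (∀ x {b} → lookup x i ≡ b → f x ≃ g b x) →
  𝔼[ σ ] f ≃ avg (𝔼[ (i , false) ∷ σ ] g false) (𝔼[ (i , true) ∷ σ ] g true)
𝔼[]-branch σ i eq f g f≃g = ℚP.≃-trans (𝔼-split i (λ x → f (override σ x)))
  (avg-cong (𝔼[]-cong ((i , false) ∷ σ) {f} {g false} λ x → f≃g (override ((i , false) ∷ σ) x) (override-new σ x i false eq))
            (𝔼[]-cong ((i , true) ∷ σ) {f} {g true} λ x → f≃g (override ((i , true) ∷ σ) x) (override-new σ x i true eq)))

------------------------------------------------------------------------
-- Moments of randomised trees under a partial assignment

-- The product of the conditional means of several trees.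
∏μ : ∀ {n} → List (RDT n) → Vec Bool n → ℚᵘ
∏μ []       x = 1ℚᵘ
∏μ (R ∷ Rs) x = μ R x ℚ.* ∏μ Rs x

-- The expectation of ∏μ under σ.  The trees are walked one after the other;
-- a query of a free variable averages over its two values and records the
-- value taken in σ, so that later queries of it, in this tree or in the
-- following ones, are answered consistently.  moment∷ walks the first tree.
moment  : ∀ {n} → Assignment n → List (RDT n) → Frac
moment∷ : ∀ {n} → Assignment n → RDT n → List (RDT n) → Frac
moment σ []       = oneF
moment σ (R ∷ Rs) = moment∷ σ R Rs
moment∷ σ (leaf ℓ)        Rs = labelFrac ℓ ⊗ moment σ Rs
moment∷ σ (toss t₀ t₁)    Rs = mid (moment∷ σ t₀ Rs) (moment∷ σ t₁ Rs)
moment∷ σ (query i t₀ t₁) Rs with find σ i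
... | just false = moment∷ σ t₀ Rs
... | just true  = moment∷ σ t₁ Rs
... | nothing    = mid (moment∷ ((i , false) ∷ σ) t₀ Rs) (moment∷ ((i , true) ∷ σ) t₁ Rs)

⟦moment⟧  : ∀ {n} (σ : Assignment n) Rs → ⟦ moment σ Rs ⟧ ≃ 𝔼[ σ ] ∏μ Rs
⟦moment∷⟧ : ∀ {n} (σ : Assignment n) R Rs → ⟦ moment∷ σ R Rs ⟧ ≃ 𝔼[ σ ] ∏μ (R ∷ Rs)
⟦moment⟧ {n} σ []   = ℚP.≃-sym (𝔼-const n 1ℚᵘ)
⟦moment⟧ σ (R ∷ Rs) = ⟦moment∷⟧ σ R Rs
⟦moment∷⟧ {n} σ (leaf ℓ) Rs = begin
  ⟦ labelFrac ℓ ⊗ moment σ Rs ⟧              ≈⟨ ⟦⊗⟧ (labelFrac ℓ) (moment σ Rs) ⟩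
  ⟦ labelFrac ℓ ⟧ ℚ.* ⟦ moment σ Rs ⟧        ≈⟨ ℚP.*-cong (ℚP.≃-reflexive (⟦labelFrac⟧ ℓ)) (⟦moment⟧ σ Rs) ⟩
  Label.value ℓ ℚ.* (𝔼[ σ ] ∏μ Rs)            ≈⟨ 𝔼-* n (Label.value ℓ) (λ x → ∏μ Rs (override σ x)) ⟨
  (𝔼[ σ ] ∏μ (leaf ℓ ∷ Rs))                  ∎
  where open ≃-Reasoning
⟦moment∷⟧ {n} σ (toss t₀ t₁) Rs = begin
  ⟦ mid (moment∷ σ t₀ Rs) (moment∷ σ t₁ Rs) ⟧
    ≈⟨ ⟦mid⟧ (moment∷ σ t₀ Rs) (moment∷ σ t₁ Rs) ⟩
  avg ⟦ moment∷ σ t₀ Rs ⟧ ⟦ moment∷ σ t₁ Rs ⟧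
    ≈⟨ avg-cong (⟦moment∷⟧ σ t₀ Rs) (⟦moment∷⟧ σ t₁ Rs) ⟩
  avg (𝔼[ σ ] ∏μ (t₀ ∷ Rs)) (𝔼[ σ ] ∏μ (t₁ ∷ Rs))
    ≈⟨ 𝔼-avg n (λ x → ∏μ (t₀ ∷ Rs) (override σ x)) (λ x → ∏μ (t₁ ∷ Rs) (override σ x)) ⟨
  (𝔼[ σ ] λ x → avg (∏μ (t₀ ∷ Rs) x) (∏μ (t₁ ∷ Rs) x))
    ≈⟨ 𝔼[]-cong σ {λ x → avg (∏μ (t₀ ∷ Rs) x) (∏μ (t₁ ∷ Rs) x)} {∏μ (toss t₀ t₁ ∷ Rs)} (λ x → pointwise (override σ x)) ⟩
  (𝔼[ σ ] ∏μ (toss t₀ t₁ ∷ Rs))              ∎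
  where
  open ≃-Reasoning
  pointwise : ∀ x → avg (∏μ (t₀ ∷ Rs) x) (∏μ (t₁ ∷ Rs) x) ≃ ∏μ (toss t₀ t₁ ∷ Rs) x
  pointwise x = ℚP.≃-trans (ℚP.≃-sym (avg-*ʳ (μ t₀ x) (μ t₁ x) (∏μ Rs x)))
    (ℚP.*-congʳ {∏μ Rs x} {avg (μ t₀ x) (μ t₁ x)} {μ (toss t₀ t₁) x} (ℚP.≃-sym (μ-toss t₀ t₁ x)))
⟦moment∷⟧ {n} σ (query i t₀ t₁) Rs = go
  where
  pointwise : ∀ x {b} → lookup x i ≡ b → ∏μ (query i t₀ t₁ ∷ Rs) x ≃ ∏μ (choose b t₀ t₁ ∷ Rs) x
  pointwise x {b} eq = ℚP.*-congʳ {∏μ Rs x} {μ (query i t₀ t₁) x} {μ (choose b t₀ t₁) x} (μ-query i t₀ t₁ x eq)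
  go : ⟦ moment∷ σ (query i t₀ t₁) Rs ⟧ ≃ 𝔼[ σ ] ∏μ (query i t₀ t₁ ∷ Rs)
  go with find σ i in eq
  ... | just false = ℚP.≃-trans (⟦moment∷⟧ σ t₀ Rs) (ℚP.≃-sym
          (𝔼[]-cong σ {∏μ (query i t₀ t₁ ∷ Rs)} {∏μ (t₀ ∷ Rs)} λ x → pointwise _ (override-just σ x i eq)))
  ... | just true  = ℚP.≃-trans (⟦moment∷⟧ σ t₁ Rs) (ℚP.≃-sym
          (𝔼[]-cong σ {∏μ (query i t₀ t₁ ∷ Rs)} {∏μ (t₁ ∷ Rs)} λ x → pointwise _ (override-just σ x i eq)))
  ... | nothing    = ℚP.≃-trans
          (⟦mid⟧ (moment∷ ((i , false) ∷ σ) t₀ Rs) (moment∷ ((i , true) ∷ σ) t₁ Rs))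
          (ℚP.≃-trans
            (avg-cong (⟦moment∷⟧ ((i , false) ∷ σ) t₀ Rs) (⟦moment∷⟧ ((i , true) ∷ σ) t₁ Rs))
            (ℚP.≃-sym (𝔼[]-branch σ i eq (∏μ (query i t₀ t₁ ∷ Rs)) (λ b → ∏μ (choose b t₀ t₁ ∷ Rs)) pointwise)))

moment-proper  : ∀ {n} (σ : Assignment n) Rs → Proper (moment σ Rs)
moment∷-proper : ∀ {n} (σ : Assignment n) R Rs → Proper (moment∷ σ R Rs)
moment-proper σ []       = proper ≤-refl
moment-proper σ (R ∷ Rs) = moment∷-proper σ R Rs
moment∷-proper σ (leaf ℓ) Rs = ⊗-proper (labelFrac-proper ℓ) (moment-proper σ Rs)
moment∷-proper σ (toss t₀ t₁) Rs = mid-proper (moment∷-proper σ t₀ Rs) (moment∷-proper σ t₁ Rs)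
moment∷-proper σ (query i t₀ t₁) Rs with find σ i
... | just false = moment∷-proper σ t₀ Rs
... | just true  = moment∷-proper σ t₁ Rs
... | nothing    = mid-proper (moment∷-proper ((i , false) ∷ σ) t₀ Rs) (moment∷-proper ((i , true) ∷ σ) t₁ Rs)

properLabel : ∀ p → Proper p → Label
properLabel p pp = record
  { value = ⟦ p ⟧
  ; 0≤    = ≤-lift (0 /1+ 0) p z≤n
  ; ≤1    = ≤-lift p oneF (subst₂ _≤_ (sym (*-identityʳ (num p))) (sym (*-identityˡ (den p))) (num≤den pp))
  }

------------------------------------------------------------------------
-- Mean squared error under a partial assignment

gap : ∀ {n} → DDT n → RDT n → Vec Bool n → ℚᵘ
gap D R x = square (evalD D x ℚ.- μ R x)

gap-query : ∀ {n} i (D₀ D₁ : DDT n) R x {b} → lookup x i ≡ b →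
  gap (query i D₀ D₁) R x ≃ gap (choose b D₀ D₁) R x
gap-query i D₀ D₁ R x {false} eq rewrite eq = ℚP.≃-refl
gap-query i D₀ D₁ R x {true}  eq rewrite eq = ℚP.≃-refl

-- Mean squared error of D under a random completion of σ.
error[_] : ∀ {n} → Assignment n → DDT n → RDT n → ℚᵘ
error[ σ ] D R = 𝔼[ σ ] gap D R

0≤error : ∀ {n} (σ : Assignment n) D R → 0ℚᵘ ℚ.≤ error[ σ ] D R
0≤error {n} σ D R = ℚP.≤-respˡ-≃ (𝔼-const n 0ℚᵘ)
  (𝔼-mono n λ x → 0≤square (evalD D (override σ x) ℚ.- μ R (override σ x)))

module _ {n} (σ : Assignment n) (R : RDT n) where
  -- First and second moment of the conditional mean of R under σ.
  mean second : ℚᵘ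
  mean   = 𝔼[ σ ] ∏μ (R ∷ [])
  second = 𝔼[ σ ] ∏μ (R ∷ R ∷ [])

  -- The expansion of E (l - f) ^ 2 by linearity.
  error-leaf : ∀ ℓ → let l = Label.value ℓ in
    error[ σ ] (leaf ℓ) R ≃ second ℚ.+ (ℚ.- (l ℚ.+ l) ℚ.* mean ℚ.+ l ℚ.* l)
  error-leaf ℓ = begin
    error[ σ ] (leaf ℓ) R
      ≈⟨ 𝔼[]-cong σ {λ x → square (l ℚ.- μ R x)} {λ x → f x ℚ.+ g x} (λ x → square-expand l (μ R (override σ x))) ⟩
    (𝔼[ σ ] λ x → f x ℚ.+ g x)
      ≈⟨ 𝔼-+ n (λ x → f (override σ x)) (λ x → g (override σ x)) ⟩
    second ℚ.+ (𝔼[ σ ] g)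
      ≈⟨ ℚP.+-congʳ second (𝔼-+ n (λ x → k ℚ.* h (override σ x)) (λ _ → l ℚ.* l)) ⟩
    second ℚ.+ ((𝔼[ σ ] λ x → k ℚ.* h x) ℚ.+ 𝔼 n (λ _ → l ℚ.* l))
      ≈⟨ ℚP.+-congʳ second (ℚP.+-cong (𝔼-* n k (λ x → h (override σ x))) (𝔼-const n (l ℚ.* l))) ⟩
    second ℚ.+ (k ℚ.* mean ℚ.+ l ℚ.* l) ∎
    where
    open ≃-Reasoning
    l = Label.value ℓ
    k = ℚ.- (l ℚ.+ l)
    f g h : Vec Bool n → ℚᵘ
    f = ∏μ (R ∷ R ∷ [])
    h = ∏μ (R ∷ [])
    g x = k ℚ.* h x ℚ.+ l ℚ.* l

  -- A constant has error at least the variance, with equality at the mean.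
  variance≤error : ∀ ℓ → second ℚ.- mean ℚ.* mean ℚ.≤ error[ σ ] (leaf ℓ) R
  variance≤error ℓ = ℚP.≤-respʳ-≃
    (ℚP.≃-trans (complete-square (Label.value ℓ) mean second) (ℚP.≃-sym (error-leaf ℓ)))
    (ℚP.p≤p+q (second ℚ.- mean ℚ.* mean) (square (Label.value ℓ ℚ.- mean))
      {{ℚ.nonNegative (0≤square (Label.value ℓ ℚ.- mean))}})

  error-mean : ∀ ℓ → Label.value ℓ ≃ mean → error[ σ ] (leaf ℓ) R ≃ second ℚ.- mean ℚ.* mean
  error-mean ℓ l≃m = ℚP.≃-trans (error-leaf ℓ) (ℚP.+-congʳ second (begin
    ℚ.- (l ℚ.+ l) ℚ.* mean ℚ.+ l ℚ.* l
      ≈⟨ ℚP.+-congʳ (ℚ.- (l ℚ.+ l) ℚ.* mean) (ℚP.*-congˡ {l} l≃m) ⟩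
    ℚ.- (l ℚ.+ l) ℚ.* mean ℚ.+ l ℚ.* mean
      ≈⟨ cancel-double l mean ⟩
    ℚ.- (l ℚ.* mean)     ≈⟨ ℚP.-‿cong (ℚP.*-congʳ {mean} l≃m) ⟩
    ℚ.- (mean ℚ.* mean)  ∎))
    where
    open ≃-Reasoning
    l = Label.value ℓ

error-query : ∀ {n} (σ : Assignment n) i D₀ D₁ R → find σ i ≡ nothing →
  error[ σ ] (query i D₀ D₁) R ≃
    avg (error[ (i , false) ∷ σ ] D₀ R) (error[ (i , true) ∷ σ ] D₁ R)
error-query σ i D₀ D₁ R eq = 𝔼[]-branch σ i eq (gap (query i D₀ D₁) R)
  (λ b → gap (choose b D₀ D₁) R) (gap-query i D₀ D₁ R)

-- Querying a variable fixed by σ amounts to continuing in one subtree.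
error-requery : ∀ {n} (σ : Assignment n) i D₀ D₁ R {b} → find σ i ≡ just b →
  error[ σ ] (query i D₀ D₁) R ≃ error[ σ ] (choose b D₀ D₁) R
error-requery σ i D₀ D₁ R {b} eq =
  𝔼[]-cong σ {gap (query i D₀ D₁) R} {gap (choose b D₀ D₁) R}
    (λ x → gap-query i D₀ D₁ R (override σ x) (override-just σ x i eq))

------------------------------------------------------------------------
-- Optimal trees of bounded depth

-- A tree together with its error.
record Candidate (n : ℕ) : Set where
  constructor candidate
  field
    err  : Frac
    tree : DDT n
open Candidate

-- The candidate of smaller error.
better : ∀ {n} → Candidate n → Candidate n → Candidate n
better c acc = if err c ≤F err acc then c else acc

-- The tree that queries i first.
join : ∀ {n} → Fin n → Candidate n → Candidate n → Candidate n
join i c₀ c₁ = candidate (mid (err c₀) (err c₁)) (query i (tree c₀) (tree c₁))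

-- The candidate that queries i and continues with the trees given by rec.
branch : ∀ {n} → (Assignment n → Candidate n) → Assignment n → Fin n → Candidate n
branch rec σ i = join i (rec ((i , false) ∷ σ)) (rec ((i , true) ∷ σ))

-- Takes variable i into account, unless σ fixes it.
step : ∀ {n} → (Assignment n → Candidate n) → Assignment n → Fin n → Candidate n → Candidate n
step rec σ i acc with find σ i
... | just _  = acc
... | nothing = better (branch rec σ i) acc

-- The best among acc and the branches on the free variables below k.
scan : ∀ {n} → (Assignment n → Candidate n) → Assignment n → (k : ℕ) → k ≤ n → Candidate n → Candidate n
scan rec σ zero    _   acc = acc
scan rec σ (suc k) k<n acc = scan rec σ k (<⇒≤ k<n) (step rec σ (fromℕ< k<n) acc)

better-elim : ∀ {n} {P : Candidate n → Set} c acc → P c → P acc → P (better c acc)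
better-elim c acc pc pa with err c ≤F err acc
... | true  = pc
... | false = pa

better≤ : ∀ {n} (c acc : Candidate n) → ⟦ err (better c acc) ⟧ ℚ.≤ ⟦ err c ⟧ × ⟦ err (better c acc) ⟧ ℚ.≤ ⟦ err acc ⟧
better≤ c acc with err c ≤F err acc in eq
... | true  = ℚP.≤-refl , ≤F-sound (err c) (err acc) eq
... | false = ≤F-sound (err c) (err acc) eq , ℚP.≤-refl

module _ {n} (rec : Assignment n → Candidate n) (σ : Assignment n) where

  -- A property that holds of acc and of the branches holds of the outcome.
  step-elim : (P : Candidate n → Set) → ∀ i acc →
    (find σ i ≡ nothing → P (branch rec σ i)) → P acc → P (step rec σ i acc)
  step-elim P i acc pb pa with find σ i in eq
  ... | just _  = pa
  ... | nothing = better-elim {P = P} (branch rec σ i) acc (pb refl) pa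

  scan-elim : (P : Candidate n → Set) → (∀ i → find σ i ≡ nothing → P (branch rec σ i)) →
    ∀ k k≤n acc → P acc → P (scan rec σ k k≤n acc)
  scan-elim P pb zero    _   acc pa = pa
  scan-elim P pb (suc k) k<n acc pa =
    scan-elim P pb k (<⇒≤ k<n) _ (step-elim P (fromℕ< k<n) acc (pb (fromℕ< k<n)) pa)

  step≤acc : ∀ i acc → ⟦ err (step rec σ i acc) ⟧ ℚ.≤ ⟦ err acc ⟧
  step≤acc i acc with find σ i
  ... | just _  = ℚP.≤-refl
  ... | nothing = proj₂ (better≤ (branch rec σ i) acc)

  step≤join : ∀ i acc → find σ i ≡ nothing →
    ⟦ err (step rec σ i acc) ⟧ ℚ.≤ ⟦ err (branch rec σ i) ⟧
  step≤join i acc eq rewrite eq = proj₁ (better≤ (branch rec σ i) acc)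

  scan≤acc : ∀ k k≤n acc → ⟦ err (scan rec σ k k≤n acc) ⟧ ℚ.≤ ⟦ err acc ⟧
  scan≤acc zero    _   acc = ℚP.≤-refl
  scan≤acc (suc k) k<n acc = ℚP.≤-trans (scan≤acc k (<⇒≤ k<n) _) (step≤acc (fromℕ< k<n) acc)

  scan≤join : ∀ k k≤n acc i → toℕ i < k → find σ i ≡ nothing →
    ⟦ err (scan rec σ k k≤n acc) ⟧ ℚ.≤ ⟦ err (branch rec σ i) ⟧
  scan≤join (suc k) k<n acc i (s≤s i≤k) eq with m≤n⇒m<n∨m≡n i≤k
  ... | inj₁ i<k = scan≤join k (<⇒≤ k<n) _ i i<k eq
  ... | inj₂ i≡k = ℚP.≤-trans (scan≤acc k (<⇒≤ k<n) (step rec σ (fromℕ< k<n) acc))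
    (subst (λ j → ⟦ err (step rec σ j acc) ⟧ ℚ.≤ ⟦ err (branch rec σ i) ⟧)
      (toℕ-injective (trans i≡k (sym (toℕ-fromℕ< k<n)))) (step≤join i acc eq))

module _ {n} (R : RDT n) where

  meanLeaf : Assignment n → DDT n
  meanLeaf σ = leaf (properLabel (moment σ (R ∷ [])) (moment-proper σ (R ∷ [])))

  -- Second moment minus squared mean, computed in natural numbers.
  varianceF : Assignment n → Frac
  varianceF σ = moment σ (R ∷ R ∷ []) ⊖ moment σ (R ∷ []) ⊗ moment σ (R ∷ [])

  -- The best tree with at most d queries under σ, with its error.  A candidate
  -- of depth d + 1 may be one of depth d, so that the error does not increase with d.
  best : ℕ → Assignment n → Candidate n
  best zero    σ = candidate (varianceF σ) (meanLeaf σ)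
  best (suc d) σ = scan (best d) σ n ≤-refl (best d σ)

  -- The recorded error is the actual one.
  Sound : Assignment n → Candidate n → Set
  Sound σ c = error[ σ ] (tree c) R ≃ ⟦ err c ⟧

  ⟦varianceF⟧ : ∀ σ → ⟦ varianceF σ ⟧ ≃ second σ R ℚ.- mean σ R ℚ.* mean σ R
  ⟦varianceF⟧ σ = ℚP.≃-trans (⟦⊖⟧ s (m ⊗ m) m²≤s) eq
    where
    s = moment σ (R ∷ R ∷ [])
    m = moment σ (R ∷ [])
    eq : ⟦ s ⟧ ℚ.- ⟦ m ⊗ m ⟧ ≃ second σ R ℚ.- mean σ R ℚ.* mean σ R
    eq = ℚP.+-cong (⟦moment⟧ σ (R ∷ R ∷ [])) (ℚP.-‿cong (ℚP.≃-trans (⟦⊗⟧ m m)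
      (ℚP.*-cong (⟦moment⟧ σ (R ∷ [])) (⟦moment⟧ σ (R ∷ [])))))
    -- The variance is the error of a leaf, hence not negative.
    m²≤s : ⟦ m ⊗ m ⟧ ℚ.≤ ⟦ s ⟧
    m²≤s = ℚP.0≤q-p⇒p≤q (ℚP.≤-respʳ-≃
      (ℚP.≃-trans (error-mean σ R (properLabel m (moment-proper σ (R ∷ []))) (⟦moment⟧ σ (R ∷ []))) (ℚP.≃-sym eq))
      (0≤error σ (meanLeaf σ) R))

  best-sound : ∀ d σ → Sound σ (best d σ)
  best-sound zero σ = ℚP.≃-trans
    (error-mean σ R (properLabel (moment σ (R ∷ [])) (moment-proper σ (R ∷ []))) (⟦moment⟧ σ (R ∷ [])))
    (ℚP.≃-sym (⟦varianceF⟧ σ))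
  best-sound (suc d) σ = scan-elim (best d) σ (Sound σ)
    (λ i eq → ℚP.≃-trans (error-query σ i (tree (best d ((i , false) ∷ σ))) (tree (best d ((i , true) ∷ σ))) R eq)
      (ℚP.≃-trans (avg-cong (best-sound d ((i , false) ∷ σ)) (best-sound d ((i , true) ∷ σ)))
        (ℚP.≃-sym (⟦mid⟧ (err (best d ((i , false) ∷ σ))) (err (best d ((i , true) ∷ σ)))))))
    n ≤-refl (best d σ) (best-sound d σ)

  best-queries : ∀ d σ → queries (tree (best d σ)) ≤ d
  best-queries zero    σ = z≤n
  best-queries (suc d) σ = scan-elim (best d) σ (λ c → queries (tree c) ≤ suc d)
    (λ i _ → s≤s (⊔-lub (best-queries d _) (best-queries d _)))
    n ≤-refl (best d σ) (m≤n⇒m≤1+n (best-queries d σ))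

  -- A query of a variable that σ fixes is skipped, at the cost of one level of
  -- depth, which scan≤acc permits.
  best-optimal : ∀ d σ D → queries D ≤ d → ⟦ err (best d σ) ⟧ ℚ.≤ error[ σ ] D R
  best-optimal zero σ (leaf ℓ) _ =
    ℚP.≤-respˡ-≃ (ℚP.≃-sym (⟦varianceF⟧ σ)) (variance≤error σ R ℓ)
  best-optimal (suc d) σ (leaf ℓ) _ =
    ℚP.≤-trans (scan≤acc (best d) σ n ≤-refl (best d σ)) (best-optimal d σ (leaf ℓ) z≤n)
  best-optimal (suc d) σ (query i D₀ D₁) (s≤s qs) with find σ i in eq
  ... | just b = ℚP.≤-trans (scan≤acc (best d) σ n ≤-refl (best d σ))
      (ℚP.≤-respʳ-≃ (ℚP.≃-sym (error-requery σ i D₀ D₁ R eq)) (sub b))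
    where
    sub : ∀ b → ⟦ err (best d σ) ⟧ ℚ.≤ error[ σ ] (choose b D₀ D₁) R
    sub false = best-optimal d σ D₀ (m⊔n≤o⇒m≤o _ _ qs)
    sub true  = best-optimal d σ D₁ (m⊔n≤o⇒n≤o (queries D₀) _ qs)
  ... | nothing = ℚP.≤-trans (scan≤join (best d) σ n ≤-refl (best d σ) i (toℕ<n i) eq)
      (ℚP.≤-respˡ-≃ (ℚP.≃-sym (⟦mid⟧ (err (best d ((i , false) ∷ σ))) (err (best d ((i , true) ∷ σ)))))
        (ℚP.≤-respʳ-≃ (ℚP.≃-sym (error-query σ i D₀ D₁ R eq))
          (avg-mono (best-optimal d ((i , false) ∷ σ) D₀ (m⊔n≤o⇒m≤o _ _ qs))
                    (best-optimal d ((i , true) ∷ σ) D₁ (m⊔n≤o⇒n≤o (queries D₀) _ qs)))))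

------------------------------------------------------------------------
-- The error vanishes at depth n

-- The tree that queries the variables ι 0 , ι 1 , … in turn and then outputs g.
full : ∀ {n} m → (Fin m → Fin n) → (Vec Bool m → Label) → DDT n
full zero    ι g = leaf (g [])
full (suc m) ι g = query (ι zero)
  (full m (ι ∘ suc) (λ v → g (false ∷ v))) (full m (ι ∘ suc) (λ v → g (true ∷ v)))

queries-full : ∀ {n} m (ι : Fin m → Fin n) g → queries (full m ι g) ≤ m
queries-full zero    ι g = z≤n
queries-full (suc m) ι g = s≤s (⊔-lub (queries-full m (ι ∘ suc) _) (queries-full m (ι ∘ suc) _))

evalD-full : ∀ {n} m (ι : Fin m → Fin n) g x →
  evalD (full m ι g) x ≡ Label.value (g (tabulate (λ j → lookup x (ι j))))
evalD-full zero    ι g x = refl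
evalD-full (suc m) ι g x with lookup x (ι zero)
... | false = evalD-full m (ι ∘ suc) (λ v → g (false ∷ v)) x
... | true  = evalD-full m (ι ∘ suc) (λ v → g (true ∷ v)) x

best-full : ∀ {n} (R : RDT n) → ⟦ err (best R n []) ⟧ ℚ.≤ 0ℚᵘ
best-full {n} R = ℚP.≤-trans (best-optimal R n [] (full n id g) (queries-full n id g))
  (ℚP.≤-reflexive (ℚP.≃-trans (𝔼-cong n λ x → exact x) (𝔼-const n 0ℚᵘ)))
  where
  g : Vec Bool n → Label
  g x = record
    { value = μ R x
    ; 0≤    = ℚP.≤-respˡ-≃ (𝔼-const (randomness R) 0ℚᵘ) (𝔼-mono (randomness R) (evalR-0≤ R x))
    ; ≤1    = ℚP.≤-respʳ-≃ (𝔼-const (randomness R) 1ℚᵘ) (𝔼-mono (randomness R) (evalR-≤1 R x))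
    }
  exact : ∀ x → square (evalD (full n id g) x ℚ.- μ R x) ≃ 0ℚᵘ
  exact x rewrite evalD-full n id g x | tabulate∘lookup x =
    ℚP.≃-trans (ℚP.*-congʳ {μ R x ℚ.- μ R x} (ℚP.+-inverseʳ (μ R x))) (ℚP.*-zeroˡ (μ R x ℚ.- μ R x))

------------------------------------------------------------------------
-- Upper bounds on running times

abstract
  -- An upper bound on the number of steps of any function body below, not
  -- counting the calls it makes.  It is abstract so that it is never unfolded.
  K : ℕ
  K = 100

  ≤K : ∀ {k} → k ≤ 100 → k ≤ K
  ≤K k≤ = k≤

module Timing {k : ℕ} (fs : Vec (Expr k 1) k) (ε : Cut) where
  open Semantics fs ε public

  -- f maps v to w in time at most t.
  record Calls (f : Fin k) (v w : Value) (t : ℕ) : Set where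
    constructor calls
    field
      {time} : ℕ
      result : v ∷ [] ⊢ lookup fs f ⇓ w ∣ time
      time≤  : time ≤ t

  calls-≤ : ∀ {f v w t u} → t ≤ u → Calls f v w t → Calls f v w u
  calls-≤ t≤u (calls r t′≤t) = calls r (≤-trans t′≤t t≤u)

  -- W bounds the lengths of all numbers on which arithmetic is done.
  module Steps (W : ℕ) (0<W : 1 ≤ W) where

    -- e evaluates to v in time at most c times W plus the times ts of the
    -- function calls made.  Each construct of the language has its rule
    -- below; c and ts are computed by these rules.
    record Run {s} (ρ : Vec Value s) (e : Expr k s) (v : Value) (c : ℕ) (ts : List ℕ) : Set where
      constructor run
      field
        {time} : ℕ
        eval   : ρ ⊢ e ⇓ v ∣ time
        time≤  : time ≤ c * W + sum ts

    module _ {s} {ρ : Vec Value s} where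

      c≤cW : ∀ c → c ≤ c * W
      c≤cW c = subst (_≤ c * W) (*-identityʳ c) (*-monoʳ-≤ c 0<W)

      ≤-extra : ∀ {t} c d ts → t ≤ c * W + sum ts → ∀ {x} → x ≤ d * W → x + t ≤ (d + c) * W + sum ts
      ≤-extra {t} c d ts t≤ {x} x≤ = begin
        x + t                      ≤⟨ +-mono-≤ x≤ t≤ ⟩
        d * W + (c * W + sum ts)   ≡⟨ +-assoc (d * W) _ _ ⟨
        d * W + c * W + sum ts     ≡⟨ cong (_+ sum ts) (*-distribʳ-+ W d c) ⟨
        (d + c) * W + sum ts       ∎
        where open ≤-Reasoning

      ≤-both : ∀ {t₁ t₂} c₁ c₂ ts₁ ts₂ → t₁ ≤ c₁ * W + sum ts₁ → t₂ ≤ c₂ * W + sum ts₂ →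
        t₁ + t₂ ≤ (c₁ + c₂) * W + sum (ts₁ ++ ts₂)
      ≤-both {t₁} {t₂} c₁ c₂ ts₁ ts₂ t₁≤ t₂≤ = begin
        t₁ + t₂                                        ≤⟨ +-mono-≤ t₁≤ t₂≤ ⟩
        (c₁ * W + sum ts₁) + (c₂ * W + sum ts₂)
          ≡⟨ solve 5 (λ c d w s t → (c :* w :+ s) :+ (d :* w :+ t) := (c :+ d) :* w :+ (s :+ t))
               refl c₁ c₂ W (sum ts₁) (sum ts₂) ⟩
        (c₁ + c₂) * W + (sum ts₁ + sum ts₂)            ≡⟨ cong (λ z → (c₁ + c₂) * W + z) (sum-++ ts₁ ts₂) ⟨
        (c₁ + c₂) * W + sum (ts₁ ++ ts₂)               ∎
        where open ≤-Reasoning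

      1≤1W : 1 ≤ 1 * W
      1≤1W = c≤cW 1

      both : ∀ {t₁ t₂} c₁ c₂ ts₁ ts₂ → t₁ ≤ c₁ * W + sum ts₁ → t₂ ≤ c₂ * W + sum ts₂ →
        suc (t₁ + t₂) ≤ suc (c₁ + c₂) * W + sum (ts₁ ++ ts₂)
      both c₁ c₂ ts₁ ts₂ t₁≤ t₂≤ = ≤-extra (c₁ + c₂) 1 (ts₁ ++ ts₂) (≤-both c₁ c₂ ts₁ ts₂ t₁≤ t₂≤) 1≤1W

      arith : ∀ {t₁ t₂ x y} c₁ c₂ ts₁ ts₂ → t₁ ≤ c₁ * W + sum ts₁ → t₂ ≤ c₂ * W + sum ts₂ →
        x ≤ W → y ≤ W →
        suc (t₁ + t₂ + (x + y)) ≤ (3 + (c₁ + c₂)) * W + sum (ts₁ ++ ts₂)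
      arith {t₁} {t₂} {x} {y} c₁ c₂ ts₁ ts₂ t₁≤ t₂≤ x≤ y≤ =
        subst (_≤ (3 + (c₁ + c₂)) * W + sum (ts₁ ++ ts₂)) (cong suc (+-comm (x + y) (t₁ + t₂)))
          (≤-extra (c₁ + c₂) 3 (ts₁ ++ ts₂) (≤-both c₁ c₂ ts₁ ts₂ t₁≤ t₂≤) {suc (x + y)}
            (+-mono-≤ 0<W (+-mono-≤ x≤ (subst (y ≤_) (sym (+-identityʳ W)) y≤))))

      rvar : ∀ i → Run ρ (var i) (lookup ρ i) 1 []
      rvar i = run ⇓var (≤-trans 1≤1W (m≤m+n _ 0))

      rlit : ∀ m → Run ρ (lit m) (nat m) (bits m) []
      rlit m = run ⇓lit (≤-trans (c≤cW (bits m)) (m≤m+n _ 0))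

      rcons : ∀ {e₁ e₂ v₁ v₂ c₁ c₂ ts₁ ts₂} → Run ρ e₁ v₁ c₁ ts₁ → Run ρ e₂ v₂ c₂ ts₂ →
        Run ρ (cons e₁ e₂) (pair v₁ v₂) (suc (c₁ + c₂)) (ts₁ ++ ts₂)
      rcons {c₁ = c₁} {c₂} {ts₁} {ts₂} (run r₁ t₁) (run r₂ t₂) = run (⇓cons r₁ r₂) (both c₁ c₂ ts₁ ts₂ t₁ t₂)

      rfst : ∀ {e v w c ts} → Run ρ e (pair v w) c ts → Run ρ (fst e) v (suc c) ts
      rfst {c = c} {ts} (run r t) = run (⇓fst r) (≤-extra c 1 ts t 1≤1W)

      rsnd : ∀ {e v w c ts} → Run ρ e (pair v w) c ts → Run ρ (snd e) w (suc c) ts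
      rsnd {c = c} {ts} (run r t) = run (⇓snd r) (≤-extra c 1 ts t 1≤1W)

      module _ {e₁ e₂ : Expr k s} {a b c₁ c₂ ts₁ ts₂}
               (R₁ : Run ρ e₁ (nat a) c₁ ts₁) (R₂ : Run ρ e₂ (nat b) c₂ ts₂)
               (a≤ : bits a ≤ W) (b≤ : bits b ≤ W) where
        open Run
        rplus : Run ρ (plus e₁ e₂) (nat (a + b)) (3 + (c₁ + c₂)) (ts₁ ++ ts₂)
        rplus = run (⇓plus (eval R₁) (eval R₂)) (arith c₁ c₂ ts₁ ts₂ (time≤ R₁) (time≤ R₂) a≤ b≤)

        rmonus : Run ρ (monus e₁ e₂) (nat (a ∸ b)) (3 + (c₁ + c₂)) (ts₁ ++ ts₂)
        rmonus = run (⇓monus (eval R₁) (eval R₂)) (arith c₁ c₂ ts₁ ts₂ (time≤ R₁) (time≤ R₂) a≤ b≤)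

        rmult : Run ρ (mult e₁ e₂) (nat (a * b)) (3 + (c₁ + c₂)) (ts₁ ++ ts₂)
        rmult = run (⇓mult (eval R₁) (eval R₂)) (arith c₁ c₂ ts₁ ts₂ (time≤ R₁) (time≤ R₂) a≤ b≤)

        rleq : Run ρ (leq e₁ e₂) (truth (a ≤ᵇ b)) (3 + (c₁ + c₂)) (ts₁ ++ ts₂)
        rleq = run (⇓leq (eval R₁) (eval R₂)) (arith c₁ c₂ ts₁ ts₂ (time≤ R₁) (time≤ R₂) a≤ b≤)

      rfrac : ∀ {e₁ e₂ a b c₁ c₂ ts₁ ts₂} → Run ρ e₁ (nat a) c₁ ts₁ → Run ρ e₂ (nat (suc b)) c₂ ts₂ →
        bits a ≤ W → bits (suc b) ≤ W →
        Run ρ (fracLeqε e₁ e₂) (truth (Cut.atMost ε (mkℚᵘ (+ a) b))) (3 + (c₁ + c₂)) (ts₁ ++ ts₂)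
      rfrac {c₁ = c₁} {c₂} {ts₁} {ts₂} (run r₁ t₁) (run r₂ t₂) a≤ b≤ =
        run (⇓fracLeqε r₁ r₂) (arith c₁ c₂ ts₁ ts₂ t₁ t₂ a≤ b≤)

      rthen : ∀ {e e₁ e₂ m v c c₁ ts ts₁} → Run ρ e (nat (suc m)) c ts → Run ρ e₁ v c₁ ts₁ →
        Run ρ (cond e e₁ e₂) v (suc (c + c₁)) (ts ++ ts₁)
      rthen {c = c} {c₁} {ts} {ts₁} (run r t) (run r₁ t₁) = run (⇓condᵗ r r₁) (both c c₁ ts ts₁ t t₁)

      relse : ∀ {e e₁ e₂ v c c₂ ts ts₂} → Run ρ e (nat 0) c ts → Run ρ e₂ v c₂ ts₂ →
        Run ρ (cond e e₁ e₂) v (suc (c + c₂)) (ts ++ ts₂)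
      relse {c = c} {c₂} {ts} {ts₂} (run r t) (run r₂ t₂) = run (⇓condᶠ r r₂) (both c c₂ ts ts₂ t t₂)

      rbind : ∀ {e₁ e₂ v₁ v₂ c₁ c₂ ts₁ ts₂} → Run ρ e₁ v₁ c₁ ts₁ → Run (v₁ ∷ ρ) e₂ v₂ c₂ ts₂ →
        Run ρ (bind e₁ e₂) v₂ (suc (c₁ + c₂)) (ts₁ ++ ts₂)
      rbind {c₁ = c₁} {c₂} {ts₁} {ts₂} (run r₁ t₁) (run r₂ t₂) = run (⇓bind r₁ r₂) (both c₁ c₂ ts₁ ts₂ t₁ t₂)

      rcall : ∀ {f e v w c ts t} → Run ρ e v c ts → Calls f v w t →
        Run ρ (call f e) w (suc c) (ts ++ (t ∷ []))
      rcall {c = c} {ts} {t} (run r t≤) (calls r′ t′≤) = run (⇓call r r′)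
        (subst (λ x → _ ≤ suc x * W + sum (ts ++ (t ∷ []))) (+-identityʳ c)
          (both c 0 ts (t ∷ []) t≤ (≤-trans t′≤ (m≤m+n t 0))))

    -- A function whose body takes at most 100 steps besides its calls.
    returns : ∀ {f v w c ts} → Run (v ∷ []) (lookup fs f) w c ts → {_ : T (c ≤ᵇ 100)} →
      Calls f v w (K * W + sum ts)
    returns {c = c} {ts} (run r t≤) {c≤} = calls r
      (≤-trans t≤ (+-monoˡ-≤ (sum ts) (*-monoˡ-≤ W (≤K (≤ᵇ⇒≤ c 100 c≤)))))

------------------------------------------------------------------------
-- Binary lengths of fractions

-- The accessibility proof is general because the logarithm recurses on it.
log2-< : ∀ m (a : WF.Acc _<_ m) → m < 2 ^ suc (⌊log2⌋ m a)
log2-< 0 _ = s≤s z≤n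
log2-< 1 _ = s≤s (s≤s z≤n)
log2-< (suc m′@(suc m)) (WF.acc rs) = begin
  3 + m                        ≡⟨ cong (λ z → 3 + z) (⌊n/2⌋+⌈n/2⌉≡n m) ⟨
  3 + (h + ⌈ m /2⌉)            ≤⟨ +-monoʳ-≤ 3 (+-monoʳ-≤ h (⌊n/2⌋-mono (n≤1+n (suc m)))) ⟩
  3 + (h + suc h)              ≡⟨ solve 1 (λ h → con 3 :+ (h :+ (con 1 :+ h)) := con 2 :* (con 2 :+ h)) refl h ⟩
  2 * (2 + h)                  ≤⟨ *-monoʳ-≤ 2 (log2-< (suc h) (rs (⌊n/2⌋<n m′))) ⟩
  2 ^ suc (suc (⌊log2⌋ (suc h) (rs (⌊n/2⌋<n m′)))) ∎
  where
  open ≤-Reasoning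
  h = ⌊ m /2⌋

m≤2^bits : ∀ m → m ≤ 2 ^ bits m
m≤2^bits m = <⇒≤ (log2-< m (<-wellFounded m))

bits-≤ : ∀ {m} L → m ≤ 2 ^ L → bits m ≤ suc L
bits-≤ L m≤ = s≤s (≤-trans (⌊log₂⌋-mono-≤ m≤) (≤-reflexive (⌊log₂[2^n]⌋≡n L)))

m≤2^m : ∀ m → m ≤ 2 ^ m
m≤2^m zero    = z≤n
m≤2^m (suc m) = +-mono-≤ (m^n>0 2 m) (≤-trans (m≤2^m m) (m≤m+n _ 0))

bits≤1+ : ∀ m → bits m ≤ suc m
bits≤1+ m = bits-≤ m (m≤2^m m)

^-distribʳ-* : ∀ k m n → (m * n) ^ k ≡ m ^ k * n ^ k
^-distribʳ-* zero    m n = refl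
^-distribʳ-* (suc k) m n = trans (cong (m * n *_) (^-distribʳ-* k m n))
  (solve 4 (λ m n x y → m :* n :* (x :* y) := m :* x :* (n :* y)) refl m n (m ^ k) (n ^ k))

-- Numerator and denominator have at most L + 1 bits.
record Bounded (L : ℕ) (p : Frac) : Set where
  constructor bounded
  field
    num≤ : num p ≤ 2 ^ L
    den≤ : den p ≤ 2 ^ L
open Bounded

*-≤2^ : ∀ {a b} L₁ L₂ → a ≤ 2 ^ L₁ → b ≤ 2 ^ L₂ → a * b ≤ 2 ^ (L₁ + L₂)
*-≤2^ L₁ L₂ a≤ b≤ = ≤-trans (*-mono-≤ a≤ b≤) (≤-reflexive (sym (^-distribˡ-+-* 2 L₁ L₂)))

-- The same with the exponents in the opposite order.
*-≤2^′ : ∀ {a b} L₁ L₂ → a ≤ 2 ^ L₂ → b ≤ 2 ^ L₁ → a * b ≤ 2 ^ (L₁ + L₂)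
*-≤2^′ {a} {b} L₁ L₂ a≤ b≤ = subst (_≤ 2 ^ (L₁ + L₂)) (*-comm b a) (*-≤2^ L₁ L₂ b≤ a≤)

double-≤2^ : ∀ {a b} L → a ≤ 2 ^ L → b ≤ 2 ^ L → a + b ≤ 2 ^ suc L
double-≤2^ L a≤ b≤ = +-mono-≤ a≤ (≤-trans b≤ (m≤m+n _ 0))

≤2^-mono : ∀ {a L L′} → L ≤ L′ → a ≤ 2 ^ L → a ≤ 2 ^ L′
≤2^-mono L≤ a≤ = ≤-trans a≤ (^-monoʳ-≤ 2 L≤)

bounded-mono : ∀ {L L′ p} → L ≤ L′ → Bounded L p → Bounded L′ p
bounded-mono L≤ (bounded n≤ d≤) = bounded (≤2^-mono L≤ n≤) (≤2^-mono L≤ d≤)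

⊗-bounded : ∀ L₁ L₂ {p q} → Bounded L₁ p → Bounded L₂ q → Bounded (L₁ + L₂) (p ⊗ q)
⊗-bounded L₁ L₂ bp bq = bounded (*-≤2^ L₁ L₂ (num≤ bp) (num≤ bq)) (*-≤2^ L₁ L₂ (den≤ bp) (den≤ bq))

⊖-bounded : ∀ L₁ L₂ {p q} → Bounded L₁ p → Bounded L₂ q → Bounded (L₁ + L₂) (p ⊖ q)
⊖-bounded L₁ L₂ {p} {q} bp bq = bounded
  (≤-trans (m∸n≤m (num p * den q) (num q * den p)) (*-≤2^ L₁ L₂ (num≤ bp) (den≤ bq))) (*-≤2^ L₁ L₂ (den≤ bp) (den≤ bq))

mid-bounded : ∀ L₁ L₂ {p q} → Bounded L₁ p → Bounded L₂ q → Bounded (suc (L₁ + L₂)) (mid p q)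
mid-bounded L₁ L₂ bp bq = bounded
  (double-≤2^ (L₁ + L₂) (*-≤2^ L₁ L₂ (num≤ bp) (den≤ bq)) (*-≤2^′ L₁ L₂ (num≤ bq) (den≤ bp)))
  (double-≤2^ (L₁ + L₂) (*-≤2^ L₁ L₂ (den≤ bp) (den≤ bq)) (*-≤2^ L₁ L₂ (den≤ bp) (den≤ bq)))

labelFrac-bounded : ∀ ℓ → Bounded (size (encodeLabel ℓ)) (labelFrac ℓ)
labelFrac-bounded ℓ = bounded
  (≤2^-mono (m≤n⇒m≤1+n (m≤m+n (bits (num (labelFrac ℓ))) (bits (den (labelFrac ℓ))))) (m≤2^bits (num (labelFrac ℓ))))
  (≤2^-mono (m≤n⇒m≤1+n (m≤n+m (bits (den (labelFrac ℓ))) (bits (num (labelFrac ℓ))))) (m≤2^bits (den (labelFrac ℓ))))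

------------------------------------------------------------------------
-- The program

-- Positions of the functions of the program.
timesᶠ minusᶠ midᶠ findᶠ momentᶠ betterᶠ joinᶠ bestᶠ scanᶠ loopᶠ : Fin 10
timesᶠ  = # 0
minusᶠ  = # 1
midᶠ    = # 2
findᶠ   = # 3
momentᶠ = # 4
betterᶠ = # 5
joinᶠ   = # 6
bestᶠ   = # 7
scanᶠ   = # 8
loopᶠ   = # 9

-- The innermost variables in scope.
v₀ : ∀ {s} → Expr 10 (suc s)
v₀ = var zero
v₁ : ∀ {s} → Expr 10 (suc (suc s))
v₁ = var (suc zero)
v₂ : ∀ {s} → Expr 10 (suc (suc (suc s)))
v₂ = var (suc (suc zero))

infixr 5 _,,_
_,,_ : ∀ {s} → Expr 10 s → Expr 10 s → Expr 10 s
_,,_ = cons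

-- The function bodies.  timesE, minusE and midE compute _⊗_, _⊖_ and mid, loopE
-- and mainE try the depths one by one, and each of the others mirrors the
-- function of the same name above.  Arguments are nested pairs.
timesE minusE midE findE momentE betterE joinE bestE scanE loopE mainE : Expr 10 1

-- argument of the next three: fraction , fraction
timesE = mult (fst (fst v₀)) (fst (snd v₀)) ,, mult (snd (fst v₀)) (snd (snd v₀))

minusE = monus (mult (fst (fst v₀)) (snd (snd v₀))) (mult (fst (snd v₀)) (snd (fst v₀)))
  ,, mult (snd (fst v₀)) (snd (snd v₀))

midE = plus (mult (fst (fst v₀)) (snd (snd v₀))) (mult (fst (snd v₀)) (snd (fst v₀)))
  ,, bind (mult (snd (fst v₀)) (snd (snd v₀))) (plus v₀ v₀)

-- argument: variable , assignment
findE = cond (fst (snd v₀))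
  (bind (call findᶠ (fst v₀ ,, snd (snd (snd v₀))))
    (cond v₀ v₀
      (cond (mult (leq (fst v₁) (fst (snd (snd v₁)))) (leq (fst (snd (snd v₁))) (fst v₁)))
        (fst (snd v₁))
        (lit 0))))
  (lit 0)

-- The assignment σ extended by the variable i, with tag 1 for false and 2 for true.
extendE : ∀ {s} → ℕ → Expr 10 s → Expr 10 s → Expr 10 s
extendE tag i σ = lit tag ,, i ,, σ

-- The moment of R and the trees Rs under σ.
moment∷E : ∀ {s} → Expr 10 s → Expr 10 s → Expr 10 s → Expr 10 s
moment∷E σ R Rs = call momentᶠ (σ ,, lit 1 ,, R ,, Rs)

-- argument: assignment , trees.  The tag of a tree is 0 for a leaf, 1 for a
-- query and 2 for a toss.
momentE = cond (fst (snd v₀))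
  (bind (fst (snd (snd v₀)))
    (cond (fst v₀)
      (cond (monus (fst v₀) (lit 1))
        (call midᶠ (moment∷E (fst v₁) (fst (snd v₀)) (snd (snd (snd v₁)))
                 ,, moment∷E (fst v₁) (snd (snd v₀)) (snd (snd (snd v₁)))))
        (bind (call findᶠ (fst (snd v₀) ,, fst v₁))
          (cond v₀
            (cond (monus v₀ (lit 1))
              (moment∷E (fst v₂) (snd (snd (snd v₁))) (snd (snd (snd v₂))))
              (moment∷E (fst v₂) (fst (snd (snd v₁))) (snd (snd (snd v₂)))))
            (call midᶠ
              (moment∷E (extendE 1 (fst (snd v₁)) (fst v₂)) (fst (snd (snd v₁))) (snd (snd (snd v₂)))
              ,, moment∷E (extendE 2 (fst (snd v₁)) (fst v₂)) (snd (snd (snd v₁))) (snd (snd (snd v₂))))))))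
      (call timesᶠ (snd v₀ ,, call momentᶠ (fst v₁ ,, snd (snd (snd v₁)))))))
  (lit 1 ,, lit 1)

-- argument: new candidate , old candidate
betterE = cond (leq (mult (fst (fst (fst v₀))) (snd (fst (snd v₀))))
                    (mult (fst (fst (snd v₀))) (snd (fst (fst v₀)))))
  (fst v₀) (snd v₀)

-- argument: variable , candidate , candidate
joinE = call midᶠ (fst (fst (snd v₀)) ,, fst (snd (snd v₀)))
  ,, lit 1 ,, fst v₀ ,, snd (fst (snd v₀)) ,, snd (snd (snd v₀))

-- argument: assignment , depth , n , R.  At depth 0 the number n is not read,
-- since its length is not bounded by the size of R.
bestE = cond (fst (snd v₀))
  (bind (monus (fst (snd v₀)) (lit 1))
    (call scanᶠ (fst v₁ ,, v₀ ,, snd (snd v₁) ,, fst (snd (snd v₁))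
      ,, call bestᶠ (fst v₁ ,, v₀ ,, snd (snd v₁)))))
  (bind (moment∷E (fst v₀) (snd (snd (snd v₀))) (lit 0 ,, lit 0))
    (call minusᶠ (moment∷E (fst v₁) (snd (snd (snd v₁))) (lit 1 ,, snd (snd (snd v₁)) ,, lit 0 ,, lit 0)
               ,, call timesᶠ (v₀ ,, v₀))
     ,, lit 0 ,, v₀))

-- argument: assignment , depth , (n , R) , number of variables left , candidate
scanE = cond (fst (snd (snd (snd v₀))))
  (bind (monus (fst (snd (snd (snd v₀)))) (lit 1))
    (bind (call findᶠ (v₀ ,, fst v₁))
      (call scanᶠ (fst v₂ ,, fst (snd v₂) ,, fst (snd (snd v₂)) ,, v₁ ,,
        cond v₀ (snd (snd (snd (snd v₂))))
          (call betterᶠ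
            (call joinᶠ (v₁ ,, call bestᶠ (extendE 1 v₁ (fst v₂) ,, fst (snd v₂) ,, fst (snd (snd v₂)))
                            ,, call bestᶠ (extendE 2 v₁ (fst v₂) ,, fst (snd v₂) ,, fst (snd (snd v₂))))
            ,, snd (snd (snd (snd v₂)))))))))
  (snd (snd (snd (snd v₀))))

-- argument: depth , n , R.  The depth is increased until the error is at most ε.
loopE = bind (call bestᶠ ((lit 0 ,, lit 0) ,, v₀))
  (cond (fracLeqε (fst (fst v₀)) (snd (fst v₀)))
    (snd v₀)
    (call loopᶠ (plus (fst v₁) (lit 1) ,, snd v₁)))

mainE = call loopᶠ (lit 0 ,, v₀)

functions : Vec (Expr 10 1) 10
functions = timesE ∷ minusE ∷ midE ∷ findE ∷ momentE ∷ betterE ∷ joinE ∷ bestE ∷ scanE ∷ loopE ∷ []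

instanceOpt : Program
instanceOpt = record { functions = functions ; main = mainE }

------------------------------------------------------------------------
-- Values handled by the program and their sizes

bit : Bool → ℕ
bit false = 0
bit true  = 1

-- Encodings of fractions, assignments, answers of find, lists of trees and
-- candidates.
encF : Frac → Value
encF p = pair (nat (num p)) (nat (den p))

encA : ∀ {n} → Assignment n → Value
encA []            = pair (nat 0) (nat 0)
encA ((i , b) ∷ σ) = pair (nat (suc (bit b))) (pair (nat (toℕ i)) (encA σ))

encM : Maybe Bool → Value
encM nothing  = nat 0
encM (just b) = nat (suc (bit b))

encL : ∀ {n} → List (RDT n) → Value
encL []       = pair (nat 0) (nat 0)
encL (R ∷ Rs) = pair (nat 1) (pair (encode R) (encL Rs))

encC : ∀ {n} → Candidate n → Value
encC c = pair (encF (err c)) (encode (tree c))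

truth≡ : ∀ b → truth b ≡ nat (bit b)
truth≡ false = refl
truth≡ true  = refl

-- Two comparisons decide equality.
same-yes : ∀ m → bit (m ≤ᵇ m) * bit (m ≤ᵇ m) ≡ 1
same-yes m with m ≤ᵇ m in eq
... | true  = refl
... | false = contradiction (subst T eq (≤⇒≤ᵇ (≤-refl {m}))) λ ()

same-no : ∀ {a b} → a ≢ b → bit (a ≤ᵇ b) * bit (b ≤ᵇ a) ≡ 0
same-no {a} {b} a≢b with a ≤ᵇ b in eq | b ≤ᵇ a in eq′
... | false | _     = refl
... | true  | false = refl
... | true  | true  = contradiction
  (≤-antisym (≤ᵇ⇒≤ a b (subst T (sym eq) tt)) (≤ᵇ⇒≤ b a (subst T (sym eq′) tt))) a≢b

length<size : ∀ {n} (σ : Assignment n) → length σ < size (encA σ)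
length<size []            = s≤s z≤n
length<size ((i , b) ∷ σ) = s≤s (≤-trans (length<size σ)
  (≤-trans (m≤n⇒m≤1+n (m≤n+m _ (bits (toℕ i)))) (m≤n+m _ (bits (suc (bit b))))))

-- Total length of the descriptions.
lengths : ∀ {n} → List (RDT n) → ℕ
lengths []       = 0
lengths (R ∷ Rs) = descriptionLength R + lengths Rs

-- Bound on the lengths of the numbers in a moment.
precision : ∀ {n} → List (RDT n) → ℕ
precision []       = 0
precision (R ∷ Rs) = descriptionLength R * suc (precision Rs)

-- Recording the answer to a query needs no more room than the query itself
-- occupies in its tree, compare query-size.
size-extend : ∀ {n} i b (σ : Assignment n) → size (encA ((i , b) ∷ σ)) ≤ 4 + bits (toℕ i) + size (encA σ)
size-extend i false σ = ≤-trans (n≤1+n _) (≤-reflexive refl)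
size-extend i true  σ = ≤-reflexive refl

-- The bound for a node, when a bound c for the remaining trees is multiplied by
-- the sizes of the subtrees.
node-≤ : ∀ a b c {N} → suc (a + b) ≤ N → suc (a * suc c + b * suc c) ≤ N * suc c
node-≤ a b c {N} h = begin
  suc (a * suc c + b * suc c)  ≡⟨ cong suc (*-distribʳ-+ (suc c) a b) ⟨
  suc ((a + b) * suc c)        ≤⟨ +-monoˡ-≤ ((a + b) * suc c) (s≤s z≤n) ⟩
  suc c + (a + b) * suc c      ≤⟨ *-monoˡ-≤ (suc c) h ⟩
  N * suc c                    ∎
  where open ≤-Reasoning

toss-size : ∀ {n} (t₀ t₁ : RDT n) → suc (descriptionLength t₀ + descriptionLength t₁) ≤ descriptionLength (toss t₀ t₁)
toss-size t₀ t₁ = ≤-trans (m≤n+m _ 3) (≤-reflexive refl)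

query-size : ∀ {n} i (t₀ t₁ : RDT n) →
  4 + bits (toℕ i) + (descriptionLength t₀ + descriptionLength t₁) ≡ descriptionLength (query i t₀ t₁)
query-size i t₀ t₁ = cong (λ z → 3 + z) (sym (+-suc (bits (toℕ i)) _))

query-size′ : ∀ {n} i (t₀ t₁ : RDT n) → suc (descriptionLength t₀ + descriptionLength t₁) ≤ descriptionLength (query i t₀ t₁)
query-size′ i t₀ t₁ = ≤-trans
  (+-monoˡ-≤ (descriptionLength t₀ + descriptionLength t₁) {1} {4 + bits (toℕ i)} (s≤s z≤n))
  (≤-reflexive (query-size i t₀ t₁))

leaf-≤ : ∀ s p → s + p ≤ (2 + s) * suc p
leaf-≤ s p = begin
  s + p                    ≤⟨ m≤m+n (s + p) (2 + p + s * p) ⟩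
  s + p + (2 + p + s * p)  ≡⟨ solve 2 (λ s p → s :+ p :+ (con 2 :+ p :+ s :* p) := (con 2 :+ s) :* (con 1 :+ p)) refl s p ⟩
  (2 + s) * suc p          ∎
  where open ≤-Reasoning

moment-bounded  : ∀ {n} (σ : Assignment n) Rs → Bounded (precision Rs) (moment σ Rs)
moment∷-bounded : ∀ {n} (σ : Assignment n) R Rs → Bounded (precision (R ∷ Rs)) (moment∷ σ R Rs)
moment-bounded σ []       = bounded ≤-refl ≤-refl
moment-bounded σ (R ∷ Rs) = moment∷-bounded σ R Rs
moment∷-bounded σ (leaf ℓ) Rs = bounded-mono (leaf-≤ (size (encodeLabel ℓ)) (precision Rs))
  (⊗-bounded (size (encodeLabel ℓ)) (precision Rs) (labelFrac-bounded ℓ) (moment-bounded σ Rs))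
moment∷-bounded σ (toss t₀ t₁) Rs = bounded-mono
  (node-≤ (descriptionLength t₀) (descriptionLength t₁) (precision Rs) (toss-size t₀ t₁))
  (mid-bounded (precision (t₀ ∷ Rs)) (precision (t₁ ∷ Rs))
    (moment∷-bounded σ t₀ Rs) (moment∷-bounded σ t₁ Rs))
moment∷-bounded {n} σ (query i t₀ t₁) Rs = body
  where
  p₀ = precision (t₀ ∷ Rs)
  p₁ = precision (t₁ ∷ Rs)
  node : suc (p₀ + p₁) ≤ precision (query i t₀ t₁ ∷ Rs)
  node = node-≤ (descriptionLength t₀) (descriptionLength t₁) (precision Rs) (query-size′ i t₀ t₁)
  body : Bounded (precision (query i t₀ t₁ ∷ Rs)) (moment∷ σ (query i t₀ t₁) Rs)
  body with find σ i
  ... | just false = bounded-mono (≤-trans (≤-trans (m≤m+n p₀ p₁) (n≤1+n _)) node)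
    (moment∷-bounded σ t₀ Rs)
  ... | just true  = bounded-mono (≤-trans (≤-trans (m≤n+m p₁ p₀) (n≤1+n _)) node)
    (moment∷-bounded σ t₁ Rs)
  ... | nothing    = bounded-mono node (mid-bounded p₀ p₁
    (moment∷-bounded ((i , false) ∷ σ) t₀ Rs) (moment∷-bounded ((i , true) ∷ σ) t₁ Rs))

------------------------------------------------------------------------
-- Correctness and running time of the functions of the program

module Analysis (ε : Cut) where
  open Timing functions ε public

  module Cost (W : ℕ) (2≤W : 2 ≤ W) where
    1≤W : 1 ≤ W
    1≤W = ≤-trans (s≤s z≤n) 2≤W

    open Steps W 1≤W public

    -- Time of a body without calls, and of a lookup.
    U F : ℕ
    U = K * W + 0
    F = W * U

    small : ∀ {m} L → L < W → m ≤ 2 ^ L → bits m ≤ W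
    small L L<W m≤ = ≤-trans (bits-≤ L m≤) L<W

    bits-bit : ∀ b → bits (bit b) ≤ W
    bits-bit false = 1≤W
    bits-bit true  = 1≤W

    module _ (L₁ L₂ : ℕ) (L< : L₁ + L₂ < W) {p q : Frac} (bp : Bounded L₁ p) (bq : Bounded L₂ q) where
      private
        L = L₁ + L₂
        L₁< : L₁ < W
        L₁< = ≤-trans (s≤s (m≤m+n L₁ L₂)) L<
        L₂< : L₂ < W
        L₂< = ≤-trans (s≤s (m≤n+m L₂ L₁)) L<
        np : bits (num p) ≤ W
        np = small L₁ L₁< (num≤ bp)
        dp : bits (den p) ≤ W
        dp = small L₁ L₁< (den≤ bp)
        nq : bits (num q) ≤ W
        nq = small L₂ L₂< (num≤ bq)
        dq : bits (den q) ≤ W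
        dq = small L₂ L₂< (den≤ bq)
        nd : bits (num p * den q) ≤ W
        nd = small L L< (*-≤2^ L₁ L₂ (num≤ bp) (den≤ bq))
        dn : bits (num q * den p) ≤ W
        dn = small L L< (*-≤2^′ L₁ L₂ (num≤ bq) (den≤ bp))
        dd : bits (den p * den q) ≤ W
        dd = small L L< (*-≤2^ L₁ L₂ (den≤ bp) (den≤ bq))

        ρ : Vec Value 1
        ρ = pair (encF p) (encF q) ∷ []

        nump : Run ρ (fst (fst v₀)) (nat (num p)) _ _
        nump = rfst (rfst (rvar zero))
        denp : Run ρ (snd (fst v₀)) (nat (den p)) _ _
        denp = rsnd (rfst (rvar zero))
        numq : Run ρ (fst (snd v₀)) (nat (num q)) _ _
        numq = rfst (rsnd (rvar zero))
        denq : Run ρ (snd (snd v₀)) (nat (den q)) _ _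
        denq = rsnd (rsnd (rvar zero))

      times-calls : Calls timesᶠ (pair (encF p) (encF q)) (encF (p ⊗ q)) U
      times-calls = returns (rcons (rmult nump numq np nq) (rmult denp denq dp dq))

      minus-calls : Calls minusᶠ (pair (encF p) (encF q)) (encF (p ⊖ q)) U
      minus-calls = returns (rcons
        (rmonus (rmult nump denq np dq) (rmult numq denp nq dp) nd dn)
        (rmult denp denq dp dq))

      mid-calls : Calls midᶠ (pair (encF p) (encF q)) (encF (mid p q)) U
      mid-calls = returns (rcons
        (rplus (rmult nump denq np dq) (rmult numq denp nq dp) nd dn)
        (rbind (rmult denp denq dp dq) (rplus (rvar zero) (rvar zero) dd dd)))

    -- The search goes to the end of the list first, since the last entry counts.
    find-calls : ∀ {n} (σ : Assignment n) i → size (encA σ) ≤ W → bits (toℕ i) ≤ W →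
      Calls findᶠ (pair (nat (toℕ i)) (encA σ)) (encM (find σ i)) (suc (length σ) * U)
    find-calls [] i s≤ i≤ = calls-≤ (≤-reflexive (sym (+-identityʳ U)))
      (returns (relse (rfst (rsnd (rvar zero))) (rlit 0)))
    find-calls ((j , b) ∷ σ) i s≤ i≤ = calls-≤ (≤-reflexive arith≡) body
      where
      T₀ = suc (length σ) * U
      arith≡ : K * W + (T₀ + 0) ≡ U + T₀
      arith≡ = solve 2 (λ k t → k :+ (t :+ con 0) := k :+ con 0 :+ t) refl (K * W) T₀
      σ≤ : size (encA σ) ≤ W
      σ≤ = ≤-trans (≤-trans (m≤n+m (size (encA σ)) (suc (bits (toℕ j))))
             (≤-trans (m≤n+m (suc (bits (toℕ j) + size (encA σ))) (bits (suc (bit b)))) (n≤1+n _))) s≤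
      j≤ : bits (toℕ j) ≤ W
      j≤ = ≤-trans (≤-trans (m≤n⇒m≤1+n (m≤m+n (bits (toℕ j)) (size (encA σ))))
             (≤-trans (m≤n+m (suc (bits (toℕ j) + size (encA σ))) (bits (suc (bit b)))) (n≤1+n _))) s≤
      asBit : ∀ {s} {ρ : Vec Value s} {e c ts} d → Run ρ e (truth d) c ts → Run ρ e (nat (bit d)) c ts
      asBit {ρ = ρ} {e} {c} {ts} d = subst (λ v → Run ρ e v c ts) (truth≡ d)
      test : ∀ {m} → bit (toℕ i ≤ᵇ toℕ j) * bit (toℕ j ≤ᵇ toℕ i) ≡ m →
        Run (nat 0 ∷ pair (nat (toℕ i)) (encA ((j , b) ∷ σ)) ∷ [])
          (mult (leq (fst v₁) (fst (snd (snd v₁)))) (leq (fst (snd (snd v₁))) (fst v₁))) (nat m) 21 []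
      test refl = rmult
        (asBit (toℕ i ≤ᵇ toℕ j) (rleq (rfst (rvar _)) (rfst (rsnd (rsnd (rvar _)))) i≤ j≤))
        (asBit (toℕ j ≤ᵇ toℕ i) (rleq (rfst (rsnd (rsnd (rvar _)))) (rfst (rvar _)) j≤ i≤))
        (bits-bit (toℕ i ≤ᵇ toℕ j)) (bits-bit (toℕ j ≤ᵇ toℕ i))
      body : Calls findᶠ (pair (nat (toℕ i)) (encA ((j , b) ∷ σ))) (encM (find ((j , b) ∷ σ) i)) (K * W + (T₀ + 0))
      body with find σ i | find-calls σ i σ≤ i≤
      ... | just c | r = returns (rthen (rfst (rsnd (rvar zero)))
        (rbind (rcall (rcons (rfst (rvar zero)) (rsnd (rsnd (rsnd (rvar zero))))) r)
          (rthen (rvar zero) (rvar zero))))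
      ... | nothing | r with i ≟ j
      ...   | yes refl = returns (rthen (rfst (rsnd (rvar zero)))
        (rbind (rcall (rcons (rfst (rvar zero)) (rsnd (rsnd (rsnd (rvar zero))))) r)
          (relse (rvar zero) (rthen (test (same-yes (toℕ i))) (rfst (rsnd (rvar _)))))))
      ...   | no i≢j = returns (rthen (rfst (rsnd (rvar zero)))
        (rbind (rcall (rcons (rfst (rvar zero)) (rsnd (rsnd (rsnd (rvar zero))))) r)
          (relse (rvar zero) (relse (test (same-no (λ e → i≢j (toℕ-injective e)))) (rlit 0)))))

    find-calls′ : ∀ {n} (σ : Assignment n) i → size (encA σ) ≤ W → bits (toℕ i) ≤ W →
      Calls findᶠ (pair (nat (toℕ i)) (encA σ)) (encM (find σ i)) F
    find-calls′ σ i s≤ i≤ = calls-≤ (*-monoˡ-≤ U (≤-trans (length<size σ) s≤)) (find-calls σ i s≤ i≤)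

    -- Time spent at one node of a tree, not counting its subtrees.
    Z : ℕ
    Z = U + (F + U)

    -- Time of a moment: every node of the first tree may lead to a moment of the
    -- rest.
    momentTime : ∀ {n} → List (RDT n) → ℕ
    momentTime []       = U
    momentTime (R ∷ Rs) = descriptionLength R * (Z + momentTime Rs)

    -- The time at a query of a free variable, the costliest kind of node: one
    -- lookup, two moments and one average.
    node-time : ∀ a b m {N} → suc (a + b) ≤ N →
      K * W + (F + (a * (Z + m) + (b * (Z + m) + (U + 0)))) ≤ N * (Z + m)
    node-time a b m {N} h = begin
      K * W + (F + (a * w + (b * w + (U + 0))))
        ≡⟨ solve 4 (λ k f x y → k :+ (f :+ (x :+ (y :+ ((k :+ con 0) :+ con 0)))) :=
             (k :+ con 0) :+ (f :+ (k :+ con 0)) :+ (x :+ y)) refl (K * W) F (a * w) (b * w) ⟩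
      Z + (a * w + b * w)      ≤⟨ +-monoˡ-≤ (a * w + b * w) (m≤m+n Z m) ⟩
      w + (a * w + b * w)      ≡⟨ cong (λ z → w + z) (*-distribʳ-+ w a b) ⟨
      suc (a + b) * w          ≤⟨ *-monoˡ-≤ w h ⟩
      N * w                    ∎
      where
      open ≤-Reasoning
      w = Z + m

    -- The time at a query of a variable that is already fixed.
    node-timeˡ : ∀ a b m {N} → suc (a + b) ≤ N → K * W + (F + (a * (Z + m) + 0)) ≤ N * (Z + m)
    node-timeˡ a b m h = ≤-trans (+-monoʳ-≤ (K * W) (+-monoʳ-≤ F (+-monoʳ-≤ (a * (Z + m)) z≤n))) (node-time a b m h)

    node-timeʳ : ∀ a b m {N} → suc (a + b) ≤ N → K * W + (F + (b * (Z + m) + 0)) ≤ N * (Z + m)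
    node-timeʳ a b m {N} h = node-timeˡ b a m (subst (λ x → suc x ≤ N) (+-comm a b) h)

    -- The time at a toss.
    node-time′ : ∀ a b m {N} → suc (a + b) ≤ N →
      K * W + (a * (Z + m) + (b * (Z + m) + (U + 0))) ≤ N * (Z + m)
    node-time′ a b m h = ≤-trans (+-monoʳ-≤ (K * W) (m≤n+m _ F)) (node-time a b m h)

    -- The room for σ and the trees together is kept constant along a path: what a
    -- query adds to σ is no more than its own size.
    moment-calls : ∀ {n} (σ : Assignment n) Rs →
      size (encA σ) + lengths Rs ≤ W → precision Rs < W →
      Calls momentᶠ (pair (encA σ) (encL Rs)) (encF (moment σ Rs)) (momentTime Rs)
    moment∷-calls : ∀ {n} (σ : Assignment n) R Rs →
      size (encA σ) + lengths (R ∷ Rs) ≤ W → precision (R ∷ Rs) < W →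
      Calls momentᶠ (pair (encA σ) (encL (R ∷ Rs))) (encF (moment∷ σ R Rs)) (momentTime (R ∷ Rs))

    moment-calls σ [] room prec = returns (relse (rfst (rsnd (rvar zero))) (rcons (rlit 1) (rlit 1)))
    moment-calls σ (R ∷ Rs) room prec = moment∷-calls σ R Rs room prec

    moment∷-calls σ (leaf ℓ) Rs room prec = calls-≤ time≤
      (returns (rthen (rfst (rsnd (rvar zero)))
        (rbind (rfst (rsnd (rsnd (rvar zero))))
          (relse (rfst (rvar zero))
            (rcall (rcons (rsnd (rvar zero)) (rcall (rcons (rfst (rvar _)) (rsnd (rsnd (rsnd (rvar _))))) rest))
              (times-calls s p sp<W (labelFrac-bounded ℓ) (moment-bounded σ Rs)))))))
      where
      s = size (encodeLabel ℓ)
      p = precision Rs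
      sp≤ : s + p ≤ precision (leaf ℓ ∷ Rs)
      sp≤ = leaf-≤ s p
      sp<W : s + p < W
      sp<W = ≤-trans (s≤s sp≤) prec
      rest : Calls momentᶠ (pair (encA σ) (encL Rs)) (encF (moment σ Rs)) (momentTime Rs)
      rest = moment-calls σ Rs (≤-trans (+-monoʳ-≤ (size (encA σ)) (m≤n+m (lengths Rs) (2 + s))) room)
        (≤-trans (s≤s (≤-trans (m≤n+m p s) sp≤)) prec)
      time≤ : K * W + (momentTime Rs + (U + 0)) ≤ (2 + s) * (Z + momentTime Rs)
      time≤ = begin
        K * W + (momentTime Rs + (U + 0))
          ≡⟨ solve 2 (λ k t →
               k :+ (t :+ ((k :+ con 0) :+ con 0)) :=
               (k :+ con 0) :+ (k :+ con 0) :+ t) refl (K * W) (momentTime Rs) ⟩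
        (U + U) + momentTime Rs           ≤⟨ +-monoˡ-≤ (momentTime Rs) (+-monoʳ-≤ U (m≤n+m U F)) ⟩
        Z + momentTime Rs                 ≤⟨ m≤m+n _ _ ⟩
        (2 + s) * (Z + momentTime Rs)     ∎
        where open ≤-Reasoning

    moment∷-calls σ (toss t₀ t₁) Rs room prec = calls-≤
      (node-time′ (descriptionLength t₀) (descriptionLength t₁) (momentTime Rs) (toss-size t₀ t₁))
      (returns (rthen (rfst (rsnd (rvar zero)))
        (rbind (rfst (rsnd (rsnd (rvar zero))))
          (rthen (rfst (rvar zero))
            (rthen (rmonus (rfst (rvar zero)) (rlit 1) 2≤W 1≤W)
              (rcall (rcons
                  (rcall (rcons (rfst (rvar _)) (rcons (rlit 1) (rcons (rfst (rsnd (rvar _))) (rsnd (rsnd (rsnd (rvar _))))))) sub₀)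
                  (rcall (rcons (rfst (rvar _)) (rcons (rlit 1) (rcons (rsnd (rsnd (rvar _))) (rsnd (rsnd (rsnd (rvar _))))))) sub₁))
                (mid-calls p₀ p₁ pp<W (moment∷-bounded σ t₀ Rs) (moment∷-bounded σ t₁ Rs))))))))
      where
      p₀ = precision (t₀ ∷ Rs)
      p₁ = precision (t₁ ∷ Rs)
      pp<W : p₀ + p₁ < W
      pp<W = ≤-trans (m≤n⇒m≤1+n (node-≤ (descriptionLength t₀) (descriptionLength t₁) (precision Rs) (toss-size t₀ t₁))) prec
      sub₀ = moment∷-calls σ t₀ Rs
        (≤-trans (+-monoʳ-≤ (size (encA σ)) (+-monoˡ-≤ (lengths Rs)
          (≤-trans (≤-trans (m≤m+n (descriptionLength t₀) (descriptionLength t₁)) (n≤1+n _)) (toss-size t₀ t₁)))) room)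
        (≤-trans (s≤s (m≤m+n p₀ p₁)) pp<W)
      sub₁ = moment∷-calls σ t₁ Rs
        (≤-trans (+-monoʳ-≤ (size (encA σ)) (+-monoˡ-≤ (lengths Rs)
          (≤-trans (≤-trans (m≤n+m (descriptionLength t₁) (descriptionLength t₀)) (n≤1+n _)) (toss-size t₀ t₁)))) room)
        (≤-trans (s≤s (m≤n+m p₁ p₀)) pp<W)

    moment∷-calls {n} σ (query i t₀ t₁) Rs room prec = body
      where
      s₀ = descriptionLength t₀
      s₁ = descriptionLength t₁
      p₀ = precision (t₀ ∷ Rs)
      p₁ = precision (t₁ ∷ Rs)
      r = lengths Rs
      open ≤-Reasoning
      pp<W : p₀ + p₁ < W
      pp<W = ≤-trans (m≤n⇒m≤1+n (node-≤ s₀ s₁ (precision Rs) (query-size′ i t₀ t₁))) prec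
      room′ : size (encA σ) + (4 + bits (toℕ i) + (s₀ + s₁) + r) ≤ W
      room′ = subst (λ x → size (encA σ) + (x + r) ≤ W) (sym (query-size i t₀ t₁)) room
      i≤ : bits (toℕ i) ≤ W
      i≤ = begin
        bits (toℕ i)                                           ≤⟨ m≤n+m _ 4 ⟩
        4 + bits (toℕ i)                                       ≤⟨ m≤m+n _ (s₀ + s₁) ⟩
        4 + bits (toℕ i) + (s₀ + s₁)                           ≤⟨ m≤m+n _ r ⟩
        4 + bits (toℕ i) + (s₀ + s₁) + r                       ≤⟨ m≤n+m _ (size (encA σ)) ⟩
        size (encA σ) + (4 + bits (toℕ i) + (s₀ + s₁) + r)     ≤⟨ room′ ⟩
        W                                                      ∎
      σ≤ : size (encA σ) ≤ W
      σ≤ = ≤-trans (m≤m+n _ _) room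
      room₀ : 4 + bits (toℕ i) + size (encA σ) + (s₀ + r) ≤ W
      room₀ = begin
        4 + bits (toℕ i) + size (encA σ) + (s₀ + r)            ≤⟨ m≤m+n _ s₁ ⟩
        4 + bits (toℕ i) + size (encA σ) + (s₀ + r) + s₁
          ≡⟨ solve 5 (λ b σ x r y → b :+ σ :+ (x :+ r) :+ y := σ :+ (b :+ (x :+ y) :+ r)) refl
               (4 + bits (toℕ i)) (size (encA σ)) s₀ r s₁ ⟩
        size (encA σ) + (4 + bits (toℕ i) + (s₀ + s₁) + r)     ≤⟨ room′ ⟩
        W                                                      ∎
      room₁ : 4 + bits (toℕ i) + size (encA σ) + (s₁ + r) ≤ W
      room₁ = begin
        4 + bits (toℕ i) + size (encA σ) + (s₁ + r)            ≤⟨ m≤m+n _ s₀ ⟩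
        4 + bits (toℕ i) + size (encA σ) + (s₁ + r) + s₀
          ≡⟨ solve 5 (λ b σ x r y → b :+ σ :+ (y :+ r) :+ x := σ :+ (b :+ (x :+ y) :+ r)) refl
               (4 + bits (toℕ i)) (size (encA σ)) s₀ r s₁ ⟩
        size (encA σ) + (4 + bits (toℕ i) + (s₀ + s₁) + r)     ≤⟨ room′ ⟩
        W                                                      ∎
      p₀<W : p₀ < W
      p₀<W = ≤-trans (s≤s (m≤m+n p₀ p₁)) pp<W
      p₁<W : p₁ < W
      p₁<W = ≤-trans (s≤s (m≤n+m p₁ p₀)) pp<W
      room₀σ : size (encA σ) + (s₀ + r) ≤ W
      room₀σ = ≤-trans (+-monoˡ-≤ (s₀ + r) (m≤n+m (size (encA σ)) (4 + bits (toℕ i)))) room₀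
      room₁σ : size (encA σ) + (s₁ + r) ≤ W
      room₁σ = ≤-trans (+-monoˡ-≤ (s₁ + r) (m≤n+m (size (encA σ)) (4 + bits (toℕ i)))) room₁
      look : ∀ {m} → Calls findᶠ (pair (nat (toℕ i)) (encA σ)) (encM m) F →
        Run (encode (query i t₀ t₁) ∷ pair (encA σ) (encL (query i t₀ t₁ ∷ Rs)) ∷ [])
          (call findᶠ (fst (snd v₀) ,, fst v₁)) (encM m) 7 (F ∷ [])
      look = rcall (rcons (rfst (rsnd (rvar _))) (rfst (rvar _)))
      body : Calls momentᶠ (pair (encA σ) (encL (query i t₀ t₁ ∷ Rs)))
        (encF (moment∷ σ (query i t₀ t₁) Rs)) (momentTime (query i t₀ t₁ ∷ Rs))
      body with find σ i | find-calls′ σ i σ≤ i≤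
      ... | just false | found = calls-≤ (node-timeˡ s₀ s₁ (momentTime Rs) (query-size′ i t₀ t₁))
        (returns (rthen (rfst (rsnd (rvar zero)))
          (rbind (rfst (rsnd (rsnd (rvar zero))))
            (rthen (rfst (rvar zero))
              (relse (rmonus (rfst (rvar zero)) (rlit 1) 1≤W 1≤W)
                (rbind (look {just false} found)
                  (rthen (rvar zero)
                    (relse (rmonus (rvar zero) (rlit 1) 1≤W 1≤W)
                      (rcall (rcons (rfst (rvar _)) (rcons (rlit 1) (rcons (rfst (rsnd (rsnd (rvar _)))) (rsnd (rsnd (rsnd (rvar _)))))))
                        (moment∷-calls σ t₀ Rs room₀σ p₀<W))))))))))
      ... | just true | found = calls-≤ (node-timeʳ s₀ s₁ (momentTime Rs) (query-size′ i t₀ t₁))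
        (returns (rthen (rfst (rsnd (rvar zero)))
          (rbind (rfst (rsnd (rsnd (rvar zero))))
            (rthen (rfst (rvar zero))
              (relse (rmonus (rfst (rvar zero)) (rlit 1) 1≤W 1≤W)
                (rbind (look {just true} found)
                  (rthen (rvar zero)
                    (rthen (rmonus (rvar zero) (rlit 1) 2≤W 1≤W)
                      (rcall (rcons (rfst (rvar _)) (rcons (rlit 1) (rcons (rsnd (rsnd (rsnd (rvar _)))) (rsnd (rsnd (rsnd (rvar _)))))))
                        (moment∷-calls σ t₁ Rs room₁σ p₁<W))))))))))
      ... | nothing | found = calls-≤ (node-time s₀ s₁ (momentTime Rs) (query-size′ i t₀ t₁))
        (returns (rthen (rfst (rsnd (rvar zero)))
          (rbind (rfst (rsnd (rsnd (rvar zero))))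
            (rthen (rfst (rvar zero))
              (relse (rmonus (rfst (rvar zero)) (rlit 1) 1≤W 1≤W)
                (rbind (look {nothing} found)
                  (relse (rvar zero)
                    (rcall (rcons
                        (rcall (rcons (rcons (rlit 1) (rcons (rfst (rsnd (rvar _))) (rfst (rvar _))))
                                  (rcons (rlit 1) (rcons (rfst (rsnd (rsnd (rvar _)))) (rsnd (rsnd (rsnd (rvar _)))))))
                          (moment∷-calls ((i , false) ∷ σ) t₀ Rs (≤-trans (+-monoˡ-≤ (s₀ + r) (size-extend i false σ)) room₀) p₀<W))
                        (rcall (rcons (rcons (rlit 2) (rcons (rfst (rsnd (rvar _))) (rfst (rvar _))))
                                  (rcons (rlit 1) (rcons (rsnd (rsnd (rsnd (rvar _)))) (rsnd (rsnd (rsnd (rvar _)))))))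
                          (moment∷-calls ((i , true) ∷ σ) t₁ Rs (≤-trans (+-monoˡ-≤ (s₁ + r) (size-extend i true σ)) room₁) p₁<W)))
                      (mid-calls p₀ p₁ pp<W (moment∷-bounded ((i , false) ∷ σ) t₀ Rs) (moment∷-bounded ((i , true) ∷ σ) t₁ Rs)))))))))) 

    module _ {n} {c₀ c₁ : Candidate n} (L : ℕ) (L< : L + L < W)
             (b₀ : Bounded L (err c₀)) (b₁ : Bounded L (err c₁)) where

      join-calls : ∀ i → Calls joinᶠ (pair (nat (toℕ i)) (pair (encC c₀) (encC c₁)))
        (encC (join i c₀ c₁)) (U + U)
      join-calls i = calls-≤ (≤-reflexive twice)
        (returns (rcons
          (rcall (rcons (rfst (rfst (rsnd (rvar zero)))) (rfst (rsnd (rsnd (rvar zero))))) (mid-calls L L L< b₀ b₁))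
          (rcons (rlit 1) (rcons (rfst (rvar zero))
            (rcons (rsnd (rfst (rsnd (rvar zero)))) (rsnd (rsnd (rsnd (rvar zero)))))))))
        where
        twice : K * W + (U + 0) ≡ U + U
        twice = solve 1 (λ k → k :+ ((k :+ con 0) :+ con 0) := (k :+ con 0) :+ (k :+ con 0)) refl (K * W)

      better-calls : Calls betterᶠ (pair (encC c₀) (encC c₁)) (encC (better c₀ c₁)) U
      better-calls = go (err c₀ ≤F err c₁) test
        where
        L₁< : L < W
        L₁< = ≤-trans (s≤s (m≤m+n L L)) L<
        ρ : Vec Value 1
        ρ = pair (encC c₀) (encC c₁) ∷ []
        test : Run ρ (leq (mult (fst (fst (fst v₀))) (snd (fst (snd v₀)))) (mult (fst (fst (snd v₀))) (snd (fst (fst v₀)))))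
                 (truth (err c₀ ≤F err c₁)) 25 []
        test = rleq
          (rmult (rfst (rfst (rfst (rvar zero)))) (rsnd (rfst (rsnd (rvar zero)))) (small L L₁< (num≤ b₀)) (small L L₁< (den≤ b₁)))
          (rmult (rfst (rfst (rsnd (rvar zero)))) (rsnd (rfst (rfst (rvar zero)))) (small L L₁< (num≤ b₁)) (small L L₁< (den≤ b₀)))
          (small (L + L) L< (*-≤2^ L L (num≤ b₀) (den≤ b₁))) (small (L + L) L< (*-≤2^ L L (num≤ b₁) (den≤ b₀)))
        go : ∀ b → Run ρ (leq (mult (fst (fst (fst v₀))) (snd (fst (snd v₀)))) (mult (fst (fst (snd v₀))) (snd (fst (fst v₀)))))
               (truth b) 25 [] → Calls betterᶠ (pair (encC c₀) (encC c₁)) (encC (if b then c₀ else c₁)) U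
        go true  t = returns (rthen t (rfst (rvar zero)))
        go false t = returns (relse t (rsnd (rvar zero)))

    module _ {n} (R : RDT n) where

      -- The part of the argument of best that stays the same.
      context : Value
      context = pair (nat n) (encode R)

      leafTime : ℕ
      leafTime = K * W + (momentTime (R ∷ []) + (momentTime (R ∷ R ∷ []) + (U + (U + 0))))

      leaf-calls : ∀ σ → size (encA σ) + lengths (R ∷ R ∷ []) ≤ W →
        precision (R ∷ R ∷ []) + (precision (R ∷ []) + precision (R ∷ [])) < W →
        Calls bestᶠ (pair (encA σ) (pair (nat 0) context)) (encC (best R 0 σ)) leafTime
      leaf-calls σ room prec = returns (relse (rfst (rsnd (rvar zero)))
        (rbind (rcall (rcons (rfst (rvar zero)) (rcons (rlit 1) (rcons (rsnd (rsnd (rsnd (rvar zero)))) (rcons (rlit 0) (rlit 0)))))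
            (moment-calls σ (R ∷ []) room₁ (≤-trans (s≤s (≤-trans (m≤m+n p₁ p₁) (m≤n+m _ p₂))) prec)))
          (rcons
            (rcall (rcons
                (rcall (rcons (rfst (rvar _)) (rcons (rlit 1) (rcons (rsnd (rsnd (rsnd (rvar _))))
                         (rcons (rlit 1) (rcons (rsnd (rsnd (rsnd (rvar _)))) (rcons (rlit 0) (rlit 0)))))))
                  (moment-calls σ (R ∷ R ∷ []) room (≤-trans (s≤s (m≤m+n p₂ _)) prec)))
                (rcall (rcons (rvar zero) (rvar zero)) (times-calls p₁ p₁ (≤-trans (s≤s (m≤n+m _ p₂)) prec) bm bm)))
              (minus-calls p₂ (p₁ + p₁) prec (moment-bounded σ (R ∷ R ∷ [])) (⊗-bounded p₁ p₁ bm bm)))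
            (rcons (rlit 0) (rvar zero)))))
        where
        p₁ = precision (R ∷ [])
        p₂ = precision (R ∷ R ∷ [])
        bm = moment-bounded σ (R ∷ [])
        room₁ : size (encA σ) + lengths (R ∷ []) ≤ W
        room₁ = ≤-trans (+-monoʳ-≤ (size (encA σ)) (+-monoʳ-≤ (descriptionLength R) z≤n)) room

      -- One level of the search: the trees for the extensions of σ are given.
      module Level (d L : ℕ) (σ : Assignment n) (rec : Assignment n → Candidate n) (T₀ : ℕ)
                   (rec-calls : ∀ i b → Calls bestᶠ (pair (encA ((i , b) ∷ σ)) (pair (nat d) context)) (encC (rec ((i , b) ∷ σ))) T₀)
                   (rec-bounded : ∀ i b → Bounded L (err (rec ((i , b) ∷ σ))))
                   (L<W : suc (L + L) + suc (L + L) < W)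
                   (σ≤ : size (encA σ) ≤ W) (n<W : n < W) where

        -- Time for one variable.
        G : ℕ
        G = U + (F + (T₀ + (T₀ + ((U + U) + U))))

        LL<W : L + L < W
        LL<W = ≤-trans (s≤s (≤-trans (n≤1+n (L + L)) (m≤m+n _ _))) L<W

        branch-bounded : ∀ i → Bounded (suc (L + L)) (err (branch rec σ i))
        branch-bounded i = mid-bounded L L (rec-bounded i false) (rec-bounded i true)

        -- One variable, with f and next describing the rest of the scan.
        scan-step : ∀ {k} i → toℕ i ≡ k → k < n → (f : Candidate n → Candidate n) →
          (∀ c → Bounded (suc (L + L)) (err c) → Calls scanᶠ
            (pair (encA σ) (pair (nat d) (pair context (pair (nat k) (encC c))))) (encC (f c)) (U + k * G)) →
          ∀ c → Bounded (suc (L + L)) (err c) → Calls scanᶠ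
            (pair (encA σ) (pair (nat d) (pair context (pair (nat (suc k)) (encC c))))) (encC (f (step rec σ i c))) (U + suc k * G)
        scan-step i refl k<n f next acc ba = body
          where
          m = toℕ i
          Tk = U + m * G
          m≤W : bits m ≤ W
          m≤W = ≤-trans (bits≤1+ m) (≤-trans k<n (<⇒≤ n<W))
          sm≤W : bits (suc m) ≤ W
          sm≤W = ≤-trans (bits≤1+ (suc m)) (≤-trans (s≤s k<n) n<W)
          used : K * W + (F + (T₀ + (T₀ + ((U + U) + (U + (Tk + 0)))))) ≤ U + suc m * G
          used = ≤-reflexive (solve 4 (λ k f t g →
            k :+ (f :+ (t :+ (t :+ (((k :+ con 0) :+ (k :+ con 0)) :+ ((k :+ con 0) :+ (((k :+ con 0) :+ g) :+ con 0)))))) :=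
            (k :+ con 0) :+ (((k :+ con 0) :+ (f :+ (t :+ (t :+ (((k :+ con 0) :+ (k :+ con 0)) :+ (k :+ con 0)))))) :+ g))
            refl (K * W) F T₀ (m * G))
          skipped : K * W + (F + (Tk + 0)) ≤ U + suc m * G
          skipped = ≤-trans (+-monoʳ-≤ (K * W) (+-monoʳ-≤ F
            (≤-trans (m≤n+m (Tk + 0) (T₀ + (T₀ + ((U + U) + U))))
              (≤-reflexive (solve 3 (λ t u k → (t :+ (t :+ ((u :+ u) :+ u))) :+ k := t :+ (t :+ ((u :+ u) :+ (u :+ k)))) refl T₀ U (Tk + 0))))))
            used
          look : ∀ {r} → Calls findᶠ (pair (nat m) (encA σ)) (encM r) F →
            Run (nat m ∷ pair (encA σ) (pair (nat d) (pair context (pair (nat (suc m)) (encC acc)))) ∷ [])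
              (call findᶠ (v₀ ,, fst v₁)) (encM r) 5 (F ∷ [])
          look = rcall (rcons (rvar _) (rfst (rvar _)))
          body : Calls scanᶠ (pair (encA σ) (pair (nat d) (pair context (pair (nat (suc m)) (encC acc)))))
            (encC (f (step rec σ i acc))) (U + suc m * G)
          body with find σ i | find-calls′ σ i σ≤ m≤W
          ... | just b | found = calls-≤ skipped
            (returns (rthen (rfst (rsnd (rsnd (rsnd (rvar zero)))))
              (rbind (rmonus (rfst (rsnd (rsnd (rsnd (rvar zero))))) (rlit 1) sm≤W 1≤W)
                (rbind (look {just b} found)
                  (rcall (rcons (rfst (rvar _)) (rcons (rfst (rsnd (rvar _))) (rcons (rfst (rsnd (rsnd (rvar _)))) (rcons (rvar _)
                      (rthen (rvar zero) (rsnd (rsnd (rsnd (rsnd (rvar _))))))))))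
                    (next acc ba))))))
          ... | nothing | found = calls-≤ used
            (returns (rthen (rfst (rsnd (rsnd (rsnd (rvar zero)))))
              (rbind (rmonus (rfst (rsnd (rsnd (rsnd (rvar zero))))) (rlit 1) sm≤W 1≤W)
                (rbind (look {nothing} found)
                  (rcall (rcons (rfst (rvar _)) (rcons (rfst (rsnd (rvar _))) (rcons (rfst (rsnd (rsnd (rvar _)))) (rcons (rvar _)
                      (relse (rvar zero)
                        (rcall (rcons
                            (rcall (rcons (rvar _) (rcons
                                (rcall (rcons (rcons (rlit 1) (rcons (rvar _) (rfst (rvar _)))) (rcons (rfst (rsnd (rvar _))) (rfst (rsnd (rsnd (rvar _))))))
                                  (rec-calls i false))
                                (rcall (rcons (rcons (rlit 2) (rcons (rvar _) (rfst (rvar _)))) (rcons (rfst (rsnd (rvar _))) (rfst (rsnd (rsnd (rvar _))))))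
                                  (rec-calls i true))))
                              (join-calls L LL<W (rec-bounded i false) (rec-bounded i true) i))
                            (rsnd (rsnd (rsnd (rsnd (rvar _))))))
                          (better-calls (suc (L + L)) L<W (branch-bounded i) ba)))))))
                    (next (better (branch rec σ i) acc)
                      (better-elim {P = λ c → Bounded (suc (L + L)) (err c)} (branch rec σ i) acc (branch-bounded i) ba)))))))

        scan-calls : ∀ k (k≤n : k ≤ n) acc → Bounded (suc (L + L)) (err acc) →
          Calls scanᶠ (pair (encA σ) (pair (nat d) (pair context (pair (nat k) (encC acc)))))
            (encC (scan rec σ k k≤n acc)) (U + k * G)
        scan-calls zero k≤n acc ba = calls-≤ (≤-reflexive (sym (+-identityʳ U)))
          (returns (relse (rfst (rsnd (rsnd (rsnd (rvar zero))))) (rsnd (rsnd (rsnd (rsnd (rvar zero)))))))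
        scan-calls (suc k) k<n acc ba = scan-step (fromℕ< k<n) (toℕ-fromℕ< k<n) k<n
          (scan rec σ k (<⇒≤ k<n)) (scan-calls k (<⇒≤ k<n)) acc ba

        -- One level of best, from the candidate acc of the level below.
        level-calls : bits (suc d) ≤ W → ∀ acc → Bounded (suc (L + L)) (err acc) →
          Calls bestᶠ (pair (encA σ) (pair (nat d) context)) (encC acc) T₀ →
          Calls bestᶠ (pair (encA σ) (pair (nat (suc d)) context))
            (encC (scan rec σ n ≤-refl acc)) (K * W + (T₀ + ((U + n * G) + 0)))
        level-calls d≤ acc ba acc-calls = returns (rthen (rfst (rsnd (rvar zero)))
          (rbind (rmonus (rfst (rsnd (rvar zero))) (rlit 1) d≤ 1≤W)
            (rcall (rcons (rfst (rvar _)) (rcons (rvar _) (rcons (rsnd (rsnd (rvar _))) (rcons (rfst (rsnd (rsnd (rvar _))))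
                (rcall (rcons (rfst (rvar _)) (rcons (rvar _) (rsnd (rsnd (rvar _))))) acc-calls)))))
              (scan-calls n ≤-refl acc ba))))

------------------------------------------------------------------------
-- Running time of the search at each depth, and of the whole program

1≤K : 1 ≤ K
1≤K = ≤K (s≤s z≤n)

-- Q is a bound on the room for assignments and trees, and on the lengths of the
-- numbers that occur at depth 0.
module Search {n} (R : RDT n) (Q : ℕ) where
  N L₀ : ℕ
  N  = descriptionLength R
  L₀ = precision (R ∷ R ∷ []) + (precision (R ∷ []) + precision (R ∷ []))

  -- The error found at depth d has numbers of at most L d + 1 bits.
  L : ℕ → ℕ
  L zero    = L₀
  L (suc d) = suc (L d + L d)

  -- Bound on the lengths of all numbers used at depth d.  Comparing two errors
  -- multiplies them, hence the factor 2.
  width : ℕ → ℕ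
  width d = 2 ^ d * (2 * Q)

  -- Growth of the time per level, and time at depth 0.  The constants 7 and 56
  -- come from adding up the costs in bestTime-suc and leafTime≤.
  A P : ℕ
  A = 7 * suc n
  P = 56 * (K * (Q * Q * (Q * Q)))

  bestTime : ℕ → ℕ
  bestTime d = A ^ d * P

  best-bounded : ∀ d σ → Bounded (L d) (err (best R d σ))
  best-bounded zero σ = ⊖-bounded p₂ (p₁ + p₁) (moment-bounded σ (R ∷ R ∷ []))
    (⊗-bounded p₁ p₁ (moment-bounded σ (R ∷ [])) (moment-bounded σ (R ∷ [])))
    where
    p₁ = precision (R ∷ [])
    p₂ = precision (R ∷ R ∷ [])
  best-bounded (suc d) σ = scan-elim (best R d) σ (λ c → Bounded (L (suc d)) (err c))
    (λ i _ → mid-bounded (L d) (L d) (best-bounded d ((i , false) ∷ σ)) (best-bounded d ((i , true) ∷ σ)))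
    n ≤-refl (best R d σ) (bounded-mono (m≤n⇒m≤1+n (m≤m+n (L d) (L d))) (best-bounded d σ))

  module _ (L₀<Q : L₀ < Q) where

    1≤Q : 1 ≤ Q
    1≤Q = ≤-trans (s≤s z≤n) L₀<Q

    L<2^Q : ∀ d → suc (L d) ≤ 2 ^ d * Q
    L<2^Q zero    = ≤-trans L₀<Q (≤-reflexive (sym (+-identityʳ Q)))
    L<2^Q (suc d) = begin
      2 + (L d + L d)              ≡⟨ cong suc (+-suc (L d) (L d)) ⟨
      suc (L d) + suc (L d)        ≤⟨ +-mono-≤ (L<2^Q d) (L<2^Q d) ⟩
      2 ^ d * Q + 2 ^ d * Q        ≡⟨ solve 2 (λ x q → x :* q :+ x :* q := (con 2 :* x) :* q) refl (2 ^ d) Q ⟩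
      2 ^ suc d * Q                ∎
      where open ≤-Reasoning

    LL<width : ∀ d → L d + L d < width d
    LL<width d = begin-strict
      L d + L d                <⟨ +-mono-< (L<2^Q d) (L<2^Q d) ⟩
      2 ^ d * Q + 2 ^ d * Q    ≡⟨ solve 2 (λ x q → x :* q :+ x :* q := x :* (con 2 :* q)) refl (2 ^ d) Q ⟩
      width d                  ∎
      where open ≤-Reasoning

    2^≤width : ∀ d → 2 ^ suc d ≤ width d
    2^≤width d = ≤-trans (≤-reflexive (*-comm 2 (2 ^ d))) (*-monoʳ-≤ (2 ^ d) (*-monoʳ-≤ 2 1≤Q))

    2≤width : ∀ d → 2 ≤ width d
    2≤width d = ≤-trans (*-monoʳ-≤ 2 (m^n>0 2 d)) (2^≤width d)

    Q≤width : ∀ d → Q ≤ width d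
    Q≤width d = ≤-trans (m≤m+n Q (Q + 0)) (m≤n*m (2 * Q) (2 ^ d) {{m^n≢0 2 d}})

    bits≤width : ∀ d → bits d ≤ width d
    bits≤width d = ≤-trans (bits≤1+ d) (≤-trans (m≤2^m (suc d)) (2^≤width d))

    module _ (d : ℕ) where
      private
        W = width (suc d)

      -- One lookup at depth d + 1 costs no more than the time allowed for the whole
      -- search at depth d.
      F≤ : W * (K * W + 0) ≤ bestTime d
      F≤ = begin
        W * (K * W + 0)
          ≡⟨ solve 3 (λ x k q → let w = (con 2 :* x) :* (con 2 :* q) in
               w :* (k :* w :+ con 0) := (x :* x) :* (con 16 :* (k :* (q :* q)))) refl (2 ^ d) K Q ⟩
        (2 ^ d * 2 ^ d) * (16 * (K * (Q * Q)))
          ≡⟨ cong (_* (16 * (K * (Q * Q)))) (^-distribʳ-* d 2 2) ⟨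
        4 ^ d * (16 * (K * (Q * Q)))
          ≤⟨ *-mono-≤ (^-monoˡ-≤ d {4} {A} (≤-trans (m≤m+n 4 3) (m≤m*n 7 (suc n))))
               (*-mono-≤ (m≤m+n 16 40) (*-monoʳ-≤ K (m≤m*n (Q * Q) (Q * Q) {{QQ≢0}}))) ⟩
        bestTime d ∎
        where
        open ≤-Reasoning
        QQ≢0 = >-nonZero (*-mono-≤ 1≤Q 1≤Q)

      U≤ : K * W + 0 ≤ bestTime d
      U≤ = ≤-trans (m≤n*m (K * W + 0) W {{>-nonZero (≤-trans (s≤s z≤n) (2≤width (suc d)))}}) F≤

    bestTime-suc : ∀ d → let W = width (suc d); U = K * W + 0; B = bestTime d in
      K * W + (B + ((U + n * (U + (W * U + (B + (B + ((U + U) + U)))))) + 0)) ≤ bestTime (suc d)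
    bestTime-suc d = begin
      K * W + (B + ((U + n * (U + (W * U + (B + (B + ((U + U) + U)))))) + 0))
        ≤⟨ +-mono-≤ (≤-trans (m≤m+n (K * W) 0) U≤B) (+-monoʳ-≤ B (+-monoˡ-≤ 0 (+-mono-≤ U≤B (*-monoʳ-≤ n
             (+-mono-≤ U≤B (+-mono-≤ (F≤ d) (+-monoʳ-≤ B (+-monoʳ-≤ B (+-mono-≤ (+-mono-≤ U≤B U≤B) U≤B))))))))) ⟩
      B + (B + ((B + n * (B + (B + (B + (B + ((B + B) + B)))))) + 0))
        ≤⟨ m≤m+n _ (4 * B) ⟩
      B + (B + ((B + n * (B + (B + (B + (B + ((B + B) + B)))))) + 0)) + 4 * B
        ≡⟨ solve 2 (λ t n →
             t :+ (t :+ ((t :+ n :* (t :+ (t :+ (t :+ (t :+ ((t :+ t) :+ t)))))) :+ con 0)) :+ con 4 :* t :=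
             (con 7 :* (con 1 :+ n)) :* t) refl B n ⟩
      A * B
        ≡⟨ *-assoc A (A ^ d) P ⟨
      bestTime (suc d) ∎
      where
      open ≤-Reasoning
      W = width (suc d)
      U = K * W + 0
      B = bestTime d
      U≤B = U≤ d

    -- There is room for σ, for d further variables, and for two copies of R.
    Room : ℕ → Assignment n → Set
    Room d σ = size (encA σ) + (d * (4 + n) + lengths (R ∷ R ∷ [])) ≤ Q

    room-extend : ∀ d σ i b → Room (suc d) σ → Room d ((i , b) ∷ σ)
    room-extend d σ i b room = begin
      size (encA ((i , b) ∷ σ)) + (d * (4 + n) + lengths (R ∷ R ∷ []))
        ≤⟨ +-monoˡ-≤ _ (≤-trans (size-extend i b σ) (+-monoˡ-≤ (size (encA σ)) (+-monoʳ-≤ 4 (≤-trans (bits≤1+ (toℕ i)) (toℕ<n i))))) ⟩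
      4 + n + size (encA σ) + (d * (4 + n) + lengths (R ∷ R ∷ []))
        ≡⟨ solve 4 (λ a s t l →
             a :+ s :+ (t :+ l) :=
             s :+ (a :+ t :+ l)) refl (4 + n) (size (encA σ)) (d * (4 + n)) (lengths (R ∷ R ∷ [])) ⟩
      size (encA σ) + (suc d * (4 + n) + lengths (R ∷ R ∷ [])) ≤⟨ room ⟩
      Q ∎
      where open ≤-Reasoning

    room-pred : ∀ d σ → Room (suc d) σ → Room d σ
    room-pred d σ = ≤-trans (+-monoʳ-≤ (size (encA σ)) (+-monoˡ-≤ (lengths (R ∷ R ∷ [])) (m≤n+m (d * (4 + n)) (4 + n))))

    -- Adding Q makes the induction go through: a query node takes at most Q
    -- besides its subtrees.  At depth 0 nothing is assumed on n.
    best-size : ∀ d σ → d * (4 + n) ≤ Q → descriptionLength (tree (best R d σ)) + Q ≤ 2 ^ d * (3 + 3 * Q)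
    best-size zero σ _ = begin
      suc (1 + suc (bits (num m) + bits (den m))) + Q
        ≤⟨ +-monoˡ-≤ Q (+-monoʳ-≤ 2 (s≤s (+-mono-≤ (short (num≤ bm)) (short (den≤ bm))))) ⟩
      3 + (Q + Q) + Q    ≡⟨ solve 1 (λ q → con 3 :+ (q :+ q) :+ q := con 1 :* (con 3 :+ con 3 :* q)) refl Q ⟩
      1 * (3 + 3 * Q)    ∎
      where
      open ≤-Reasoning
      m  = moment σ (R ∷ [])
      bm = moment-bounded σ (R ∷ [])
      p₁ = precision (R ∷ [])
      short : ∀ {x} → x ≤ 2 ^ p₁ → bits x ≤ Q
      short x≤ = ≤-trans (bits-≤ p₁ x≤) (≤-trans (s≤s (≤-trans (m≤m+n p₁ p₁) (m≤n+m _ (precision (R ∷ R ∷ []))))) L₀<Q)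
    best-size (suc d) σ h = scan-elim (best R d) σ (λ c → descriptionLength (tree c) + Q ≤ 2 ^ suc d * (3 + 3 * Q))
      (λ i _ → step-size i) n ≤-refl (best R d σ)
      (≤-trans (best-size d σ h′) (*-monoˡ-≤ (3 + 3 * Q) (m≤n*m (2 ^ d) 2)))
      where
      open ≤-Reasoning
      h′ : d * (4 + n) ≤ Q
      h′ = ≤-trans (m≤n+m _ (4 + n)) h
      X = 2 ^ d * (3 + 3 * Q)
      step-size : ∀ i → descriptionLength (tree (branch (best R d) σ i)) + Q ≤ 2 ^ suc d * (3 + 3 * Q)
      step-size i = begin
        descriptionLength (query i t₀ t₁) + Q
          ≡⟨ cong (_+ Q) (cong (λ z → 3 + z) (+-suc (bits (toℕ i)) (s₀ + s₁))) ⟩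
        4 + bits (toℕ i) + (s₀ + s₁) + Q
          ≤⟨ +-monoˡ-≤ Q (+-monoˡ-≤ (s₀ + s₁) (≤-trans (+-monoʳ-≤ 4 (≤-trans (bits≤1+ (toℕ i)) (toℕ<n i)))
               (≤-trans (m≤m+n (4 + n) (d * (4 + n))) h))) ⟩
        Q + (s₀ + s₁) + Q      ≡⟨ solve 3 (λ q x y → q :+ (x :+ y) :+ q := (x :+ q) :+ (y :+ q)) refl Q s₀ s₁ ⟩
        (s₀ + Q) + (s₁ + Q)    ≤⟨ +-mono-≤ (best-size d ((i , false) ∷ σ) h′) (best-size d ((i , true) ∷ σ) h′) ⟩
        X + X                  ≡⟨ solve 2 (λ x y → x :* y :+ x :* y := (con 2 :* x) :* y) refl (2 ^ d) (3 + 3 * Q) ⟩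
        2 ^ suc d * (3 + 3 * Q) ∎
        where
        t₀ = tree (best R d ((i , false) ∷ σ))
        t₁ = tree (best R d ((i , true) ∷ σ))
        s₀ = descriptionLength t₀
        s₁ = descriptionLength t₁

    best-size′ : ∀ d σ → d * (4 + n) ≤ Q → descriptionLength (tree (best R d σ)) ≤ bestTime d
    best-size′ d σ h = begin
      descriptionLength (tree (best R d σ))       ≤⟨ m≤m+n _ Q ⟩
      descriptionLength (tree (best R d σ)) + Q   ≤⟨ best-size d σ h ⟩
      2 ^ d * (3 + 3 * Q)                         ≤⟨ *-mono-≤ (^-monoˡ-≤ d {2} {A} (≤-trans (m≤m+n 2 5) (m≤m*n 7 (suc n)))) le ⟩
      bestTime d                                  ∎
      where
      open ≤-Reasoning
      Q≤ : Q ≤ K * (Q * Q * (Q * Q))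
      Q≤ = ≤-trans (m≤m*n Q (Q * (Q * Q)) {{>-nonZero (*-mono-≤ 1≤Q (*-mono-≤ 1≤Q 1≤Q))}})
        (≤-trans (≤-reflexive (sym (*-assoc Q Q (Q * Q)))) (m≤n*m _ K {{>-nonZero 1≤K}}))
      le : 3 + 3 * Q ≤ P
      le = begin
        3 + 3 * Q          ≤⟨ +-monoˡ-≤ (3 * Q) (*-monoʳ-≤ 3 1≤Q) ⟩
        3 * Q + 3 * Q      ≡⟨ *-distribʳ-+ Q 3 3 ⟨
        6 * Q              ≤⟨ *-mono-≤ (m≤m+n 6 50) Q≤ ⟩
        P                  ∎

    module _ (ε : Cut) where
      open Analysis ε

      leafTime≤ : N ≤ Q → Cost.leafTime (width 0) (2≤width 0) R ≤ bestTime 0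
      leafTime≤ N≤Q = begin
        K * W + (N * (Z + U) + (N * (Z + N * (Z + U)) + (U + (U + 0))))
          ≤⟨ +-mono-≤ (≤-trans (m≤m+n (K * W) 0) U≤F) (+-mono-≤ (*-mono-≤ N≤Q ZU≤) (+-mono-≤ (*-mono-≤ N≤Q (+-mono-≤ Z≤ (*-mono-≤ N≤Q ZU≤)))
               (+-mono-≤ U≤F (+-monoˡ-≤ 0 U≤F)))) ⟩
        F + (Q * (4 * F) + (Q * (3 * F + Q * (4 * F)) + (F + (F + 0))))
          ≡⟨ solve 2 (λ f q →
               f :+ (q :* (con 4 :* f) :+ (q :* (con 3 :* f :+ q :* (con 4 :* f)) :+ (f :+ (f :+ con 0)))) :=
               con 3 :* f :+ con 7 :* (q :* f) :+ con 4 :* (q :* q :* f)) refl F Q ⟩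
        3 * F + 7 * (Q * F) + 4 * (Q * Q * F)
          ≤⟨ +-monoˡ-≤ _ (+-mono-≤ (*-monoʳ-≤ 3 F≤QQF) (*-monoʳ-≤ 7 QF≤QQF)) ⟩
        3 * (Q * Q * F) + 7 * (Q * Q * F) + 4 * (Q * Q * F)
          ≡⟨ solve 2 (λ k q → let w = con 1 :* (con 2 :* q); f = w :* (k :* w :+ con 0); x = q :* q :* f in
               con 3 :* x :+ con 7 :* x :+ con 4 :* x := con 1 :* (con 56 :* (k :* (q :* q :* (q :* q))))) refl K Q ⟩
        bestTime 0 ∎
        where
        open ≤-Reasoning
        W = width 0
        open Cost W (2≤width 0) using (U; F; Z)
        U≤F : U ≤ F
        U≤F = m≤n*m U W {{>-nonZero (≤-trans (s≤s z≤n) (2≤width 0))}}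
        Z≤ : Z ≤ 3 * F
        Z≤ = ≤-trans (+-mono-≤ U≤F (+-monoʳ-≤ F U≤F)) (≤-reflexive (solve 1 (λ f → f :+ (f :+ f) := con 3 :* f) refl F))
        ZU≤ : Z + U ≤ 4 * F
        ZU≤ = ≤-trans (+-mono-≤ Z≤ U≤F) (≤-reflexive (+-comm (3 * F) F))
        QF≤QQF : Q * F ≤ Q * Q * F
        QF≤QQF = *-monoˡ-≤ F (m≤m*n Q Q {{>-nonZero 1≤Q}})
        F≤QQF : F ≤ Q * Q * F
        F≤QQF = ≤-trans (m≤n*m F Q {{>-nonZero 1≤Q}}) QF≤QQF

      best-calls : ∀ d σ → Room d σ →
        Calls bestᶠ (pair (encA σ) (pair (nat d) (pair (nat n) (encode R)))) (encC (best R d σ)) (bestTime d)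
      best-calls zero σ room = calls-≤ (leafTime≤ (≤-trans (≤-trans (m≤m+n N (N + 0)) (m≤n+m _ (size (encA σ)))) room))
        (Cost.leaf-calls (width 0) (2≤width 0) R σ (≤-trans room (Q≤width 0)) (≤-trans L₀<Q (Q≤width 0)))
      best-calls (suc d) σ room = calls-≤ (bestTime-suc d)
        (level-calls (bits≤width (suc d)) (best R d σ) (bounded-mono (m≤n⇒m≤1+n (m≤m+n (L d) (L d))) (best-bounded d σ))
          (best-calls d σ (room-pred d σ room)))
        where
        n<Q : n < Q
        n<Q = ≤-trans (≤-trans (m≤n+m (suc n) 3) (≤-trans (m≤m+n (4 + n) (d * (4 + n)))
          (≤-trans (m≤m+n (suc d * (4 + n)) (lengths (R ∷ R ∷ []))) (m≤n+m _ (size (encA σ)))))) room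
        open Cost (width (suc d)) (2≤width (suc d))
        open Level R d (L d) σ (best R d) (bestTime d)
          (λ i b → best-calls d ((i , b) ∷ σ) (room-extend d σ i b room))
          (λ i b → best-bounded d ((i , b) ∷ σ))
          (LL<width (suc d))
          (≤-trans (m≤m+n _ _) (≤-trans room (Q≤width (suc d))))
          (≤-trans n<Q (Q≤width (suc d)))

      -- The outer loop started at depth d stops at depth d + j.
      loop-calls : ∀ q j d → d + j ≡ q → Room q [] →
        (∀ e → e < q → Cut.atMost ε ⟦ err (best R e []) ⟧ ≡ false) → Cut.atMost ε ⟦ err (best R q []) ⟧ ≡ true →
        Calls loopᶠ (pair (nat d) (pair (nat n) (encode R))) (encode (tree (best R q [])))
          (suc j * (bestTime q + bestTime q))
      loop-calls q j d refl room before at = body j refl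
        where
        open Cost (width (suc d)) (2≤width (suc d))
        B = bestTime q
        open ≤-Reasoning
        Td≤B : bestTime d ≤ B
        Td≤B = *-monoˡ-≤ P (^-monoʳ-≤ A (m≤m+n d j))
        room-d : Room d []
        room-d = ≤-trans (+-monoʳ-≤ 3 (+-monoˡ-≤ (lengths (R ∷ R ∷ [])) (*-monoˡ-≤ (4 + n) (m≤m+n d j)))) room
        c = best R d []
        bc = best-bounded d []
        L<W : L d < width (suc d)
        L<W = ≤-trans (s≤s (≤-trans (m≤m+n (L d) (L d)) (≤-trans (n≤1+n _) (m≤m+n _ _)))) (LL<width (suc d))
        first : Run (pair (nat d) (pair (nat n) (encode R)) ∷ []) (call bestᶠ ((lit 0 ,, lit 0) ,, v₀)) (encC c) 6 (bestTime d ∷ [])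
        first = rcall (rcons (rcons (rlit 0) (rlit 0)) (rvar zero)) (best-calls d [] room-d)
        test : ∀ {b} → Cut.atMost ε ⟦ err c ⟧ ≡ b →
          Run (encC c ∷ pair (nat d) (pair (nat n) (encode R)) ∷ []) (fracLeqε (fst (fst v₀)) (snd (fst v₀))) (truth b) 9 []
        test refl = rfrac (rfst (rfst (rvar zero))) (rsnd (rfst (rvar zero))) (small (L d) L<W (num≤ bc)) (small (L d) L<W (den≤ bc))
        body : ∀ j′ → j ≡ j′ → Calls loopᶠ (pair (nat d) (pair (nat n) (encode R))) (encode (tree (best R (d + j) [])))
          (suc j * (bestTime (d + j) + bestTime (d + j)))
        body zero refl = calls-≤ le
          (subst (λ e → Calls loopᶠ (pair (nat d) (pair (nat n) (encode R))) (encode (tree (best R e []))) (K * width (suc d) + (bestTime d + 0)))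
            (sym (+-identityʳ d))
            (returns (rbind first (rthen (test (subst (λ e → Cut.atMost ε ⟦ err (best R e []) ⟧ ≡ true) (+-identityʳ d) at)) (rsnd (rvar zero))))))
          where
          le : K * width (suc d) + (bestTime d + 0) ≤ 1 * (B + B)
          le = begin
            K * width (suc d) + (bestTime d + 0)     ≤⟨ +-mono-≤ (≤-trans (m≤m+n _ 0) (≤-trans (U≤ d) Td≤B)) (+-monoˡ-≤ 0 Td≤B) ⟩
            B + (B + 0)                              ≡⟨ solve 1 (λ t → t :+ (t :+ con 0) := con 1 :* (t :+ t)) refl B ⟩
            1 * (B + B)                              ∎
        body (suc j′) refl = calls-≤ le
          (returns (rbind first (relse (test (before d (≤-trans (s≤s (m≤m+n d j′)) (≤-reflexive (sym (+-suc d j′))))))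
            (rcall (rcons (rplus (rfst (rvar _)) (rlit 1) (≤-trans (bits≤1+ d) (≤-trans (m≤2^m (suc d)) (≤-trans (m≤n*m (2 ^ suc d) 2) (2^≤width (suc d))))) 1≤W)
                (rsnd (rvar _)))
              (loop-calls q j′ (d + 1) (trans (+-assoc d 1 j′) refl) room before at)))))
          where
          le : K * width (suc d) + (bestTime d + (suc j′ * (B + B) + 0)) ≤ suc (suc j′) * (B + B)
          le = begin
            K * width (suc d) + (bestTime d + (suc j′ * (B + B) + 0))
              ≤⟨ +-mono-≤ (≤-trans (m≤m+n _ 0) (≤-trans (U≤ d) Td≤B)) (+-monoˡ-≤ (suc j′ * (B + B) + 0) Td≤B) ⟩
            B + (B + (suc j′ * (B + B) + 0))
              ≡⟨ solve 2 (λ t x → t :+ (t :+ (x :+ con 0)) := (t :+ t) :+ x) refl B (suc j′ * (B + B)) ⟩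
            suc (suc j′) * (B + B) ∎

      main-returns : ∀ q → Room q [] →
        (∀ e → e < q → Cut.atMost ε ⟦ err (best R e []) ⟧ ≡ false) → Cut.atMost ε ⟦ err (best R q []) ⟧ ≡ true →
        ∃[ time ] (Returns instanceOpt R ε (tree (best R q [])) time × time ≤ 4 * suc q * bestTime q)
      main-returns q room before at = Run.time r + descriptionLength D , record { evaluates = Run.eval r ; total = refl } , (begin
        Run.time r + descriptionLength D
          ≤⟨ +-mono-≤ (≤-trans (Run.time≤ r) (+-monoˡ-≤ _
               (≤-trans (*-monoˡ-≤ (width 1) (≤K {4} (≤ᵇ⇒≤ 4 100 tt))) (≤-trans (m≤m+n _ 0) (≤-trans (U≤ 0) T₀≤B)))))
               (best-size′ q [] (≤-trans (≤-trans (m≤m+n _ _) (m≤n+m _ 3)) room)) ⟩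
        B + (suc q * (B + B) + 0) + B
          ≤⟨ m≤m+n _ (2 * q * B) ⟩
        B + (suc q * (B + B) + 0) + B + 2 * q * B
          ≡⟨ solve 2 (λ q t →
               t :+ ((con 1 :+ q) :* (t :+ t) :+ con 0) :+ t :+ con 2 :* q :* t :=
               con 4 :* (con 1 :+ q) :* t) refl q B ⟩
        4 * suc q * B ∎)
        where
        open Cost (width 1) (2≤width 1)
        open ≤-Reasoning
        B = bestTime q
        D = tree (best R q [])
        T₀≤B : bestTime 0 ≤ B
        T₀≤B = *-monoˡ-≤ P (^-monoʳ-≤ A (z≤n {q}))
        r : Run (pair (nat n) (encode R) ∷ []) mainE (encode D) 4 (suc q * (B + B) ∷ [])
        r = rcall (rcons (rlit 0) (rvar zero)) (loop-calls q q 0 refl room before at)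

------------------------------------------------------------------------
-- The bound on the total time in terms of N, n and q⋆

-- The factor 2 on the right is needed for n = 1 only.
2^q≤2n^q : ∀ n q → q ≤ n → 2 ^ q ≤ 2 * n ^ q
2^q≤2n^q 0 zero _ = s≤s z≤n
2^q≤2n^q 1 zero _ = s≤s z≤n
2^q≤2n^q 1 (suc zero) _ = ≤-refl
2^q≤2n^q 1 (suc (suc q)) (s≤s ())
2^q≤2n^q (suc (suc n)) q _ = ≤-trans (^-monoˡ-≤ q (s≤s (s≤s z≤n))) (m≤n*m _ 2)

-- For n = 0 the hypothesis q ≤ n makes both powers equal to 1.
^-≤-* : ∀ n q {a b} → q ≤ n → a ≤ b → n ^ (a * q) ≤ n ^ (b * q)
^-≤-* zero zero {a} {b} z≤n a≤b rewrite *-zeroʳ a | *-zeroʳ b = ≤-refl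
^-≤-* (suc n) q _ a≤b = ^-monoʳ-≤ (suc n) (*-monoˡ-≤ q a≤b)

1≤n^aq : ∀ n q a → q ≤ n → 1 ≤ n ^ (a * q)
1≤n^aq n q a q≤n = ^-≤-* n q {0} {a} q≤n z≤n

^-pow : ∀ n q a → (n ^ q) ^ a ≡ n ^ (a * q)
^-pow n q a = trans (^-*-assoc n q a) (cong (n ^_) (*-comm q a))

[14n]^q≤ : ∀ n q → q ≤ n → (14 * suc n) ^ q ≤ 32 * n ^ (6 * q)
[14n]^q≤ zero zero z≤n = s≤s z≤n
[14n]^q≤ n@(suc m) q q≤n = begin
  (14 * suc n) ^ q            ≤⟨ ^-monoˡ-≤ q le ⟩
  (2 ^ 5 * n) ^ q             ≡⟨ ^-distribʳ-* q (2 ^ 5) n ⟩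
  (2 ^ 5) ^ q * n ^ q         ≡⟨ cong (_* n ^ q) (trans (^-*-assoc 2 5 q) (sym (^-pow 2 q 5))) ⟩
  (2 ^ q) ^ 5 * n ^ q         ≤⟨ *-monoˡ-≤ (n ^ q) (^-monoˡ-≤ 5 (2^q≤2n^q n q q≤n)) ⟩
  (2 * n ^ q) ^ 5 * n ^ q
    ≡⟨ solve 1 (λ x →
         let y = con 2 :* x in y :* (y :* (y :* (y :* (y :* con 1)))) :* x :=
         con 32 :* (x :* (x :* (x :* (x :* (x :* (x :* con 1))))))) refl (n ^ q) ⟩
  32 * (n ^ q) ^ 6            ≡⟨ cong (32 *_) (^-pow n q 6) ⟩
  32 * n ^ (6 * q)            ∎
  where
  open ≤-Reasoning
  le : 14 * suc n ≤ 32 * n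
  le = begin
    14 * suc n         ≡⟨ solve 1 (λ m → con 14 :* (con 2 :+ m) := con 28 :+ con 14 :* m) refl m ⟩
    28 + 14 * m        ≤⟨ +-mono-≤ (m≤m+n 28 4) (*-monoˡ-≤ m (m≤m+n 14 18)) ⟩
    32 + 32 * m        ≡⟨ *-suc 32 m ⟨
    32 * n             ∎

depth-≤ : ∀ n q → q ≤ n → q * (4 + n) ≤ 5 * n ^ (2 * q)
depth-≤ n zero _ = z≤n
depth-≤ n@(suc m) q@(suc _) q≤n = begin
  q * (4 + n)        ≤⟨ *-mono-≤ q≤n (≤-trans (+-monoˡ-≤ n (m≤m*n 4 n)) (≤-reflexive (solve 1 (λ n → con 4 :* n :+ n := con 5 :* n) refl n))) ⟩
  n * (5 * n)        ≡⟨ solve 1 (λ n → n :* (con 5 :* n) := con 5 :* (n :* (n :* con 1))) refl n ⟩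
  5 * n ^ 2          ≤⟨ *-monoʳ-≤ 5 (^-monoʳ-≤ n (m≤m*n 2 q)) ⟩
  5 * n ^ (2 * q)    ∎
  where open ≤-Reasoning

-- The constant factor of the time bound, abstract so that it is never unfolded.
abstract
  C : ℕ
  C = 128 * (56 * (K * (15 * 15 * (15 * 15))))

  C≡ : C ≡ 128 * (56 * (K * (15 * 15 * (15 * 15))))
  C≡ = refl

module _ {n} (R : RDT n) (q : ℕ) (q≤n : q ≤ n) where
  private
    N = descriptionLength R
    E = n ^ (2 * q)
    M = N * N * E
    L₀ = Search.L₀ R 0

  -- The value of Q for a search up to depth q.  Here 3 is the size of the empty
  -- assignment.
  scale : ℕ
  scale = suc L₀ + (3 + (q * (4 + n) + lengths (R ∷ R ∷ [])))

  1≤N : 1 ≤ N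
  1≤N = 1≤size (encode R)
    where
    1≤size : ∀ v → 1 ≤ size v
    1≤size (nat _)    = s≤s z≤n
    1≤size (pair _ _) = s≤s z≤n

  1≤E : 1 ≤ E
  1≤E = 1≤n^aq n q 2 q≤n

  scale≤ : scale ≤ 15 * M
  scale≤ = begin
    suc (N * suc (N * 1) + (N * 1 + N * 1)) + (3 + (q * (4 + n) + (N + (N + 0))))
      ≡⟨ solve 2 (λ N d →
           (con 1 :+ (N :* (con 1 :+ N :* con 1) :+ (N :* con 1 :+ N :* con 1))) :+ (con 3 :+ (d :+ (N :+ (N :+ con 0)))) :=
           con 4 :* con 1 :+ con 5 :* N :+ N :* N :+ d) refl N (q * (4 + n)) ⟩
    4 * 1 + 5 * N + N * N + q * (4 + n)
      ≤⟨ +-mono-≤ (+-mono-≤ (+-mono-≤ (*-monoʳ-≤ 4 1≤M) (*-monoʳ-≤ 5 N≤M)) NN≤M) (≤-trans (depth-≤ n q q≤n) (*-monoʳ-≤ 5 E≤M)) ⟩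
    4 * M + 5 * M + M + 5 * M
      ≡⟨ solve 1 (λ m → con 4 :* m :+ con 5 :* m :+ m :+ con 5 :* m := con 15 :* m) refl M ⟩
    15 * M ∎
    where
    open ≤-Reasoning
    NN≤M : N * N ≤ M
    NN≤M = m≤m*n (N * N) E {{>-nonZero 1≤E}}
    N≤M : N ≤ M
    N≤M = ≤-trans (m≤m*n N N {{>-nonZero 1≤N}}) NN≤M
    1≤M : 1 ≤ M
    1≤M = ≤-trans 1≤N N≤M
    E≤M : E ≤ M
    E≤M = m≤n*m E (N * N) {{>-nonZero (*-mono-≤ 1≤N 1≤N)}}

  -- The powers of n are 6 q from the branching and 8 q from the fourth power of
  -- scale, with n ^ (2 q) in each factor.
  time-bound : 4 * suc q * Search.bestTime R scale q ≤ C * N ^ 8 * n ^ (14 * q)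
  time-bound = begin
    4 * suc q * (A ^ q * (56 * (K * (S * S * (S * S)))))
      ≤⟨ *-monoˡ-≤ _ (*-monoʳ-≤ 4 (suc≤2^ q)) ⟩
    4 * 2 ^ q * (A ^ q * (56 * (K * (S * S * (S * S)))))
      ≡⟨ solve 3 (λ x y z →
           con 4 :* x :* (y :* z) :=
           con 4 :* (x :* y) :* z) refl (2 ^ q) (A ^ q) (56 * (K * (S * S * (S * S)))) ⟩
    4 * (2 ^ q * A ^ q) * (56 * (K * (S * S * (S * S))))
      ≤⟨ *-mono-≤ (*-monoʳ-≤ 4 2A≤) (*-monoʳ-≤ 56 (*-monoʳ-≤ K (*-mono-≤ (*-mono-≤ scale≤ scale≤) (*-mono-≤ scale≤ scale≤)))) ⟩
    4 * (32 * n ^ (6 * q)) * (56 * (K * ((15 * M) * (15 * M) * ((15 * M) * (15 * M)))))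
      ≡⟨ expand 15 (56) K N E (n ^ (6 * q)) ⟩
    128 * (56 * (K * (15 * 15 * (15 * 15)))) * N ^ 8 * (n ^ (6 * q) * E ^ 4)
      ≡⟨ cong₂ (λ c x → c * N ^ 8 * x) (sym C≡) powers ⟩
    C * N ^ 8 * n ^ (14 * q) ∎
    where
    open ≤-Reasoning
    S = scale
    A = Search.A R scale
    suc≤2^ : ∀ q → suc q ≤ 2 ^ q
    suc≤2^ zero    = ≤-refl
    suc≤2^ (suc q) = +-mono-≤ (m^n>0 2 q) (≤-trans (suc≤2^ q) (m≤m+n _ 0))
    2A≤ : 2 ^ q * A ^ q ≤ 32 * n ^ (6 * q)
    2A≤ = ≤-trans (≤-reflexive (trans (sym (^-distribʳ-* q 2 A)) (cong (_^ q) (sym (*-assoc 2 7 (suc n)))))) ([14n]^q≤ n q q≤n)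
    expand : ∀ b e k N E x →
      4 * (32 * x) * (e * (k * ((b * (N * N * E)) * (b * (N * N * E)) * ((b * (N * N * E)) * (b * (N * N * E))))))
      ≡ 128 * (e * (k * (b * b * (b * b)))) * N ^ 8 * (x * E ^ 4)
    expand = solve 6 (λ b e k N E x → let y = b :* (N :* N :* E) in
      con 4 :* (con 32 :* x) :* (e :* (k :* (y :* y :* (y :* y)))) :=
      con 128 :* (e :* (k :* (b :* b :* (b :* b)))) :* (N :^ 8) :* (x :* (E :^ 4))) refl
    powers : n ^ (6 * q) * E ^ 4 ≡ n ^ (14 * q)
    powers = trans (cong (n ^ (6 * q) *_) (trans (^-*-assoc n (2 * q) 4)
        (cong (n ^_) (trans (*-comm (2 * q) 4) (sym (*-assoc 4 2 q))))))
      (trans (sym (^-distribˡ-+-* n (6 * q) (8 * q))) (cong (n ^_) (sym (*-distribʳ-+ q 6 8))))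

------------------------------------------------------------------------
-- The least sufficient depth

-- The first argument at which a boolean predicate holds.
least : ∀ (p : ℕ → Bool) n → p n ≡ true → ∃[ q ] (q ≤ n × p q ≡ true × (∀ e → e < q → p e ≡ false))
least p n pn with p 0 in p0
... | true = 0 , z≤n , p0 , λ _ ()
least p zero pn | false = contradiction (trans (sym pn) p0) λ ()
least p (suc n) pn | false with least (λ m → p (suc m)) n pn
... | q , q≤n , pq , before = suc q , s≤s q≤n , pq , λ { zero _ → p0 ; (suc e) (s≤s e<q) → before e e<q }

T⇒≡ : ∀ {b} → T b → b ≡ true
T⇒≡ {true} _ = refl

theorem2 : ∃[ A ] ∃[ c ]
    (∀ {n : ℕ} (q : ℕ) (R : RDT n) → queries R ≤ q →
    ∀ (ε : Cut) → InUnitHalf ε →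
    ∃[ q⋆ ] (IsOptimal R ε q⋆ ×
    (∃[ D ] ∃[ time ]
    (Returns A R ε D time
    × time ≤ c * descriptionLength R ^ c * n ^ (c * q⋆)
    × queries D ≤ q⋆
    × D Approximates[ ε ] R))))
-- The depth q⋆ is the least one at which the search succeeds.  The constant c
-- serves as factor and in both exponents, hence the addition of 14.
theorem2 = instanceOpt , c , λ {n} _ R _ ε ((p , 0<p , p≤ε) , _) →
  let
    open Cut ε
    within : ℕ → Bool
    within d = atMost ⟦ err (best R d []) ⟧
    q , q≤n , at , before = least within n (T⇒≡ (down (ℚP.≤-trans (best-full R) (ℚP.<⇒≤ 0<p)) p≤ε))
    D = tree (best R q [])
    D≈R : D Approximates[ ε ] R
    D≈R = down (ℚP.≤-reflexive (best-sound R q [])) (subst T (sym at) tt)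
    optimal : ∀ q′ → Achievable R ε q′ → q ≤ q′
    optimal q′ (D′ , D′≤ , D′≈R) = ≮⇒≥ λ q′<q →
      subst T (before q′ q′<q) (down (best-optimal R q′ [] D′ D′≤) D′≈R)
    scale₀ = scale R q q≤n
    time , returned , time≤ = Search.main-returns R scale₀ (m≤m+n _ _) ε q
      (m≤n+m (3 + (q * (4 + n) + lengths (R ∷ R ∷ []))) (suc (Search.L₀ R 0))) before at
    N≢0 = >-nonZero (1≤N R q q≤n)
  in q , ((D , best-queries R q [] , D≈R) , optimal) ,
     D , time , returned ,
     ≤-trans time≤ (≤-trans (time-bound R q q≤n)
       (*-mono-≤ (*-mono-≤ (m≤m+n C 14) (^-monoʳ-≤ (descriptionLength R) {{N≢0}} (≤-trans (m≤m+n 8 6) (m≤n+m 14 C))))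
         (^-≤-* n q q≤n (m≤n+m 14 C)))) ,
     best-queries R q [] , D≈R
  where
  c = C + 14
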